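{- Let $H$ be a bipartite graph that is cyclically 3-connected. Then either $H$ is isomorphic to $K_{3,3}$, or $H$ is a subdivision of $K_4$, or $H$ has a subgraph $H'$ which is a subdivision of $K_4$ such that no cycle of $H'$ has vertex set equal to the set of branch-vertices of $H'$.
   Context: Graphs are finite and simple. A graph is $3$-connected if it has more than $3$ vertices and remains connected after deleting any $2$ vertices. A subdivision of a graph $J$ is obtained by replacing each edge $uv$ of $J$ by a path from $u$ to $v$, these paths being internally vertex-disjoint. $H$ is cyclically 3-connected if it is (isomorphic to) a subdivision of some 3-connected graph. A branch-vertex of a graph is a vertex of degree at least $3$. -}

module Defs where

open import Data.Bool.Base using (Bool; if_then_else_)
open import Data.Fin.Base using (Fin; _<_)
open import Data.Fin.Properties using (all?)
open import Data.Fin.Subset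
  using (Subset; inside; outside; ⊥; ⊤; ⁅_⁆; ∁; _∪_; _─_; _∈_; _∉_; _⊆_; ∣_∣)
open import Data.Fin.Subset.Properties
  using (_∈?_; ∉⊥; ∈⊤; x∈⁅x⁆; x∈⁅y⁆⇒x≡y; x∈∁p⇒x∉p; x∉p⇒x∈∁p;
         p─q⊆p; x∈p∧x∉q⇒x∈p─q)
open import Data.List.Base using (List; _∷_; _∷ʳ_; _++_; length)
open import Data.List.Membership.Propositional using () renaming (_∈_ to _∈ˡ_)
open import Data.List.Relation.Unary.Linked using (Linked)
open import Data.List.Relation.Unary.Unique.Propositional using (Unique)
open import Data.Nat.Base using (ℕ) renaming (_≤_ to _≤ⁿ_; _<_ to _<ⁿ_)
open import Data.Product.Base using (Σ-syntax; ∃-syntax; ∃₂; _×_)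
open import Data.Sum.Base using (_⊎_)
open import Data.Vec.Base using ([]; _∷_; lookup; there)
open import Function.Bundles using (_⇔_)
open import Relation.Binary.Construct.Closure.ReflexiveTransitive using (Star)
open import Relation.Binary.PropositionalEquality.Core
  using (_≡_; _≢_; sym; subst)
open import Relation.Nullary.Decidable using (yes; no; does; from-yes; _→-dec_; ¬?)
open import Relation.Nullary.Negation.Core using (¬_; contradiction)

infix 4 _⊑_ _≅_
infixl 5 _∖_

-- A finite simple graph whose vertex set is a subset of Fin n.  The vertex
-- set need not be all of Fin n, so that subgraphs and vertex deletions of a
-- graph are again graphs over the same Fin n.
record Graph (n : ℕ) : Set where
  field
    V        : Subset n
    N        : Fin n → Subset n
    N⊆V      : ∀ {u} → N u ⊆ V
    N-sym    : ∀ {u v} → v ∈ N u → u ∈ N v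
    N-irrefl : ∀ {u} → u ∉ N u

open Graph public

private
  variable
    m n : ℕ

Adj : Graph n → Fin n → Fin n → Set
Adj G u v = v ∈ N G u

-- Subgraphs are not required to be induced.
_⊑_ : Graph n → Graph n → Set
G ⊑ H = V G ⊆ V H × (∀ u → N G u ⊆ N H u)

-- The maps are total on Fin n and Fin m, but their values matter only on the
-- vertices.
record _≅_ (G : Graph n) (H : Graph m) : Set where
  field
    to       : Fin n → Fin m
    from     : Fin m → Fin n
    to-V     : ∀ {u} → u ∈ V G → to u ∈ V H
    from-V   : ∀ {x} → x ∈ V H → from x ∈ V G
    from∘to  : ∀ {u} → u ∈ V G → from (to u) ≡ u
    to∘from  : ∀ {x} → x ∈ V H → to (from x) ≡ x
    to-Adj   : ∀ {u v} → Adj G u v → Adj H (to u) (to v)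
    from-Adj : ∀ {x y} → Adj H x y → Adj G (from x) (from y)

private
  ─⇒∉ : ∀ (p q : Subset n) {x} → x ∈ p ─ q → x ∉ q
  ─⇒∉ (_ ∷ p) (inside  ∷ q) (there h) (there k) = ─⇒∉ p q h k
  ─⇒∉ (_ ∷ p) (outside ∷ q) (there h) (there k) = ─⇒∉ p q h k

  N∖ : Graph n → Subset n → Fin n → Subset n
  N∖ G S u = if does (u ∈? S) then ⊥ else N G u ─ S

  N∖-⊆ : ∀ (G : Graph n) S {u} → N∖ G S u ⊆ V G ─ S
  N∖-⊆ G S {u} h with u ∈? S
  ... | yes _ = contradiction h ∉⊥
  ... | no _  = x∈p∧x∉q⇒x∈p─q (N⊆V G (p─q⊆p (N G u) S h)) (─⇒∉ (N G u) S h)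

  N∖-sym : ∀ (G : Graph n) S {u v} → v ∈ N∖ G S u → u ∈ N∖ G S v
  N∖-sym G S {u} {v} h with u ∈? S
  ... | yes _   = contradiction h ∉⊥
  ... | no u∉S with v ∈? S
  ...   | yes v∈S = contradiction v∈S (─⇒∉ (N G u) S h)
  ...   | no _    = x∈p∧x∉q⇒x∈p─q (N-sym G (p─q⊆p (N G u) S h)) u∉S

  N∖-irrefl : ∀ (G : Graph n) S {u} → u ∉ N∖ G S u
  N∖-irrefl G S {u} h with u ∈? S
  ... | yes _ = ∉⊥ h
  ... | no _  = N-irrefl G (p─q⊆p (N G u) S h)

_∖_ : Graph n → Subset n → Graph n
G ∖ S = record
  { V        = V G ─ S
  ; N        = N∖ G S
  ; N⊆V      = N∖-⊆ G S
  ; N-sym    = N∖-sym G S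
  ; N-irrefl = N∖-irrefl G S
  }

Connected : Graph n → Set
Connected G = ∀ {u v} → u ∈ V G → v ∈ V G → Star (Adj G) u v

ThreeConnected : Graph n → Set
ThreeConnected G =
  3 <ⁿ ∣ V G ∣ ×
  (∀ {x y} → x ∈ V G → y ∈ V G → x ≢ y → Connected (G ∖ (⁅ x ⁆ ∪ ⁅ y ⁆)))

IsPath : Graph n → List (Fin n) → Set
IsPath G xs = Linked (Adj G) xs × Unique xs

Consecutive : Fin n → Fin n → List (Fin n) → Set
Consecutive x y zs = ∃₂ λ as bs → zs ≡ as ++ x ∷ y ∷ bs

-- Each edge uv is represented once, by its orientation with u < v.
Edge : Graph n → Fin n → Fin n → Set
Edge G u v = u < v × Adj G u v

-- H is isomorphic to a graph obtained from J by subdividing: a vertex u of J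
-- becomes ρ u, and an edge uv of J becomes the path from ρ u to ρ v whose list
-- of internal vertices is inner u v.  H consists of exactly these vertices and
-- paths.  The values of ρ off V J and of inner off the edges of J are
-- irrelevant.
record IsSubdivision (J : Graph m) (H : Graph n) : Set where
  field
    ρ     : Fin m → Fin n
    inner : Fin m → Fin m → List (Fin n)

  path : Fin m → Fin m → List (Fin n)
  path u v = ρ u ∷ inner u v ∷ʳ ρ v

  field
    ρ-V            : ∀ {u} → u ∈ V J → ρ u ∈ V H
    ρ-injective    : ∀ {u v} → u ∈ V J → v ∈ V J → ρ u ≡ ρ v → u ≡ v
    path-isPath    : ∀ {u v} → Edge J u v → IsPath H (path u v)
    inner-avoids-ρ : ∀ {u v w} → Edge J u v → w ∈ V J → ¬ (ρ w ∈ˡ inner u v)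
    inner-disjoint : ∀ {u v u′ v′ x} → Edge J u v → Edge J u′ v′ →
                     x ∈ˡ inner u v → x ∈ˡ inner u′ v′ → u ≡ u′ × v ≡ v′
    covers-V       : ∀ {x} → x ∈ V H →
                     (∃[ u ] u ∈ V J × x ≡ ρ u) ⊎
                     (∃[ u ] ∃[ v ] Edge J u v × x ∈ˡ inner u v)
    covers-E       : ∀ {x y} → Adj H x y →
                     ∃[ u ] ∃[ v ] Edge J u v ×
                       (Consecutive x y (path u v) ⊎ Consecutive y x (path u v))

Cyclically3Connected : Graph n → Set
Cyclically3Connected H =
  ∃[ m ] Σ[ J ∈ Graph m ] ThreeConnected J × IsSubdivision J H

Bipartite : Graph n → Set
Bipartite {n} G =
  Σ[ side ∈ (Fin n → Bool) ] (∀ {u v} → Adj G u v → side u ≢ side v)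

BranchVertex : Graph n → Fin n → Set
BranchVertex G v = v ∈ V G × 3 ≤ⁿ ∣ N G v ∣

-- The cycle x₀ x₁ … x_k x₀ is given by its distinct vertices x₀ ∷ x₁ ∷ … ∷ x_k.
data IsCycle (G : Graph n) : List (Fin n) → Set where
  cycle : ∀ {x xs} → 3 ≤ⁿ length (x ∷ xs) → Unique (x ∷ xs) →
          Linked (Adj G) (x ∷ xs ∷ʳ x) → IsCycle G (x ∷ xs)

HasCycleOnBranchVertices : Graph n → Set
HasCycleOnBranchVertices G =
  ∃[ xs ] IsCycle G xs × (∀ v → v ∈ˡ xs ⇔ BranchVertex G v)

complete : ∀ n → Graph n
complete n = record
  { V        = ⊤
  ; N        = λ u → ∁ ⁅ u ⁆
  ; N⊆V      = λ _ → ∈⊤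
  ; N-sym    = λ {u} {v} h → x∉p⇒x∈∁p λ u∈⁅v⁆ →
                 x∈∁p⇒x∉p h (subst (λ w → v ∈ ⁅ w ⁆) (sym (x∈⁅y⁆⇒x≡y v u∈⁅v⁆)) (x∈⁅x⁆ v))
  ; N-irrefl = λ {u} h → x∈∁p⇒x∉p h (x∈⁅x⁆ u)
  }

K₄ : Graph 4
K₄ = complete 4

K₃,₃ : Graph 6
K₃,₃ = record
  { V        = ⊤
  ; N        = nbr
  ; N⊆V      = λ _ → ∈⊤
  ; N-sym    = λ {u} {v} →
      from-yes (all? λ u → all? λ v → (v ∈? nbr u) →-dec (u ∈? nbr v)) u v
  ; N-irrefl = λ {u} →
      from-yes (all? λ u → ¬? (u ∈? nbr u)) u
  }
  where
  left : Subset 6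
  left = inside ∷ inside ∷ inside ∷ outside ∷ outside ∷ outside ∷ []
  nbr : Fin 6 → Subset 6
  nbr u = if lookup left u then ∁ left else left

{-# OPTIONS --safe #-}
-- The only use of bipartiteness is that H has no triangles, so every triangle of
-- the 3-connected graph J has a subdivided ("long") edge.  The argument takes place
-- in J; call a path long if it has an internal vertex or consists of a long edge.
--
-- A subdivision of K₄ in which two long paths leave the same branch vertex gives a
-- suitable H′: that branch vertex is adjacent in H′ to at most one other branch
-- vertex.  Suppose there is none.  A vertex with three neighbours yields a theta
-- graph, and a path avoiding its two ends that joins two of its arms yields a
-- subdivision of K₄.  Its long paths form a matching that meets every triangle, so
-- it consists of a 4-cycle abcd of short edges and long paths P from a to c and Q
-- from b to d.
--
-- If P has an internal vertex, connectivity of J − {a, c} gives a path from the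
-- interior of P to b, to d or to the interior of Q.  The first two contradict the
-- choice; the third gives a subdivision of K₃,₃, which must be a K₃,₃ of short edges
-- (else deleting an edge leaves a suitable K₄), and then any further vertex or edge
-- of J again gives two adjacent long paths, so H is K₃,₃.  The same holds for Q.  If
-- P and Q are edges and J has a further vertex, then two consecutive vertices of the
-- 4-cycle are joined by a path through new vertices, which is long and adjacent to P
-- or Q; otherwise J is K₄.

module Submission where

open import Defs
open import Data.Nat.Base using (ℕ)
open import Data.Product.Base using (_×_; Σ-syntax)
open import Data.Sum.Base using (_⊎_)
open import Relation.Nullary.Negation.Core using (¬_)

open import Algebra.Bundles using (CommutativeMonoid)
import Algebra.Solver.CommutativeMonoid as CommutativeMonoidSolver
open import Data.Bool.Base using (Bool; true; false)
open import Data.Fin.Base using (Fin; zero; suc; _<_)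
open import Data.Fin.Patterns
open import Data.Fin.Properties using (_≟_; any?; all?; _<?_; <-cmp; <-asym; <-irrefl)
open import Data.Fin.Subset using (Subset; _∈_; _∉_; ∣_∣; ⁅_⁆; _∪_; ⋃; inside; outside)
open import Data.Fin.Subset.Properties
  using (_∈?_; ∉⊥; ∈⊤; x∈⁅x⁆; x∈⁅y⁆⇒x≡y; x∈p∪q⁺; x∈p∪q⁻; x∉p⇒x∈∁p; p─q⊆p; p⊆q⇒∣p∣≤∣q∣;
         x∈p∧x∉q⇒x∈p─q; x∈p∧x≢y⇒x∈p-y; x∈p⇒∣p-x∣<∣p∣; ∣⊥∣≡0; ∣⁅x⁆∣≡1)
open import Data.List.Base
  using (List; []; _∷_; _++_; _∷ʳ_; [_]; map; concat; length; lookup; reverse)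
import Data.List.Membership.DecPropositional as DecMembership
open import Data.List.Membership.Propositional using () renaming (_∈_ to _∈ˡ_; _∉_ to _∉ˡ_)
open import Data.List.Membership.Propositional.Properties
  using (∈-∃++; ∈-++⁺ˡ; ∈-++⁺ʳ; ∈-++⁻; ∈-lookup; ∈-concat⁺′; ∈-map⁺)
open import Data.List.Properties using (reverse-++; reverse-involutive; unfold-reverse)
open import Data.List.Relation.Binary.Permutation.Propositional
  using (_↭_; ↭-refl; ↭-sym; ↭-trans; ↭-prep; ↭⇒↭ₛ)
open import Data.List.Relation.Binary.Permutation.Propositional.Properties
  using (∈-resp-↭; ↭-empty-inv; ↭-reverse; shift; ∷↭∷ʳ; ++⁺; ++⁺ˡ; ++⁺ʳ; ++-comm;
         ++-identityʳ; ++-isCommutativeMonoid)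
import Data.List.Relation.Binary.Permutation.Setoid.Properties as Permutationₛ
open import Data.List.Relation.Unary.All as All using (All; []; _∷_)
import Data.List.Relation.Unary.All.Properties as All
open import Data.List.Relation.Unary.AllPairs using ([]; _∷_)
open import Data.List.Relation.Unary.Any using (here; there; index)
open import Data.List.Relation.Unary.Any.Properties using (lookup-index; reverse⁻)
open import Data.List.Relation.Unary.Linked using (Linked; []; [-]; _∷_)
open import Data.List.Relation.Unary.Unique.Propositional using (Unique)
open import Data.List.Relation.Unary.Unique.Propositional.Properties as Unique
  using () renaming (Unique[x∷xs]⇒x∉xs to Unique-∷⇒∉)
open import Data.Nat.Base using (z≤n; s≤s) renaming (_≤_ to _≤ⁿ_; _<_ to _<ⁿ_; _+_ to _+ⁿ_)
import Data.Nat.Properties as ℕ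
open import Data.Product.Base using (∃; ∃₂; ∃-syntax; _,_; proj₁; proj₂)
open import Data.Product.Properties using (≡-dec)
open import Data.Sum.Base as Sum using (inj₁; inj₂; [_,_]′; swap)
open import Data.Vec.Base using ([]; _∷_; here; there; tabulate)
open import Data.Vec.Properties using (lookup∘tabulate; lookup⇒[]=; []=⇒lookup)
open import Function.Base using (_∘_)
open import Function.Bundles using (module Equivalence)
open import Relation.Binary.Construct.Closure.ReflexiveTransitive using (Star; ε; _◅_)
open import Relation.Binary.Definitions using (tri<; tri≈; tri>)
open import Relation.Binary.PropositionalEquality using (setoid)
open import Relation.Binary.PropositionalEquality.Core
  using (_≡_; _≢_; refl; sym; trans; cong; subst; subst₂; ≢-sym)
open import Relation.Nullary.Decidable
  using (Dec; yes; no; does; _×-dec_; _⊎-dec_; _→-dec_; ¬?; map′; dec-true; decidable-stable;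
         from-yes)
open import Relation.Nullary.Negation.Core using (contradiction)
open import Relation.Unary using (Decidable)

private
  variable
    m n                           : ℕ
    A                             : Set
    a b c d p s t u v w x y z     : Fin n
    a₁ a₂ a₃ b₁ b₂ b₃             : Fin n
    xs ys zs                      : List A
    ab ac ad bc bd cd             : List (Fin n)
    P P₁ P₂ Q Q₁ Q₂ R X Y Z       : List (Fin n)

-- Lists without repetition.

Unique-resp-↭ : xs ↭ ys → Unique xs → Unique ys
Unique-resp-↭ p = Permutationₛ.Unique-resp-↭ (setoid _) (↭⇒↭ₛ p)

Unique-++ˡ : ∀ (xs : List A) → Unique (xs ++ ys) → Unique xs
Unique-++ˡ []       _         = []
Unique-++ˡ (x ∷ xs) (h ∷ uniq) = All.++⁻ˡ xs h ∷ Unique-++ˡ xs uniq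

Unique-++ʳ : ∀ (xs : List A) → Unique (xs ++ ys) → Unique ys
Unique-++ʳ []       uniq       = uniq
Unique-++ʳ (x ∷ xs) (_ ∷ uniq) = Unique-++ʳ xs uniq

Unique-++⇒∉ : ∀ {z : A} (xs : List A) → Unique (xs ++ ys) → z ∈ˡ xs → ¬ (z ∈ˡ ys)
Unique-++⇒∉ (x ∷ xs) (h ∷ _) (here refl) z∈ys = All.lookup h (∈-++⁺ʳ xs z∈ys) refl
Unique-++⇒∉ (x ∷ xs) (_ ∷ u) (there z∈)  z∈ys = Unique-++⇒∉ xs u z∈ z∈ys

Unique-drop : xs ↭ ys ++ zs → Unique xs → Unique ys
Unique-drop {ys = ys} p = Unique-++ˡ ys ∘ Unique-resp-↭ p

Unique-++-all : ∀ {xs : List A} → Unique xs → Unique ys → All (_∉ˡ xs) ys → Unique (xs ++ ys)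
Unique-++-all ux uy h = Unique.++⁺ ux uy λ (z∈xs , z∈ys) → All.lookup h z∈ys z∈xs

++∷≢[] : ∀ (xs : List A) {y ys} → xs ++ y ∷ ys ≢ []
++∷≢[] []      ()
++∷≢[] (_ ∷ _) ()

-- Walks and paths, with their internal vertices.

infixr 5 _∷_

-- The list contains the internal vertices of the walk.
data Walk (G : Graph m) : Fin m → List (Fin m) → Fin m → Set where
  edge : Adj G u v → Walk G u [] v
  _∷_  : Adj G u x → Walk G x xs v → Walk G u (x ∷ xs) v

module _ {G : Graph m} where

  walk-++ : Walk G u xs v → Walk G v ys w → Walk G u (xs ++ v ∷ ys) w
  walk-++ (edge e) q = e ∷ q
  walk-++ (e ∷ p)  q = e ∷ walk-++ p q

  walk-split : ∀ xs → Walk G u (xs ++ x ∷ ys) v → Walk G u xs x × Walk G x ys v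
  walk-split []       (e ∷ p) = edge e , p
  walk-split (_ ∷ xs) (e ∷ p) with p₁ , p₂ ← walk-split xs p = e ∷ p₁ , p₂

  walk-reverse : Walk G u xs v → Walk G v (reverse xs) u
  walk-reverse (edge e) = edge (N-sym G e)
  walk-reverse (_∷_ {x = x} {xs = xs} e p) =
    subst (λ ys → Walk G _ ys _) (sym (unfold-reverse x xs))
      (walk-++ (walk-reverse p) (edge (N-sym G e)))

  walk-source : Walk G u xs v → u ∈ V G
  walk-source (edge e) = N⊆V G (N-sym G e)
  walk-source (e ∷ _)  = N⊆V G (N-sym G e)

-- Walks whose internal vertices are only recorded up to order, so that walks
-- can be reversed and cut without reversing lists.
Path : Graph m → Fin m → List (Fin m) → Fin m → Set
Path G u xs v = ∃[ ys ] Walk G u ys v × ys ↭ xs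

module _ {G : Graph m} where

  walk⇒path : Walk G u xs v → Path G u xs v
  walk⇒path p = _ , p , ↭-refl

  path-edge : Adj G u v → Path G u [] v
  path-edge e = [] , edge e , ↭-refl

  path-adj : Path G u [] v → Adj G u v
  path-adj (ys , p , ys↭) with refl ← ↭-empty-inv ys↭ | edge e ← p = e

  path-sym : Path G u xs v → Path G v xs u
  path-sym (ys , p , ys↭) = reverse ys , walk-reverse p , ↭-trans (↭-reverse ys) ys↭

  path-++ : Path G u xs v → Path G v ys w → Path G u (xs ++ v ∷ ys) w
  path-++ (_ , p , p↭) (_ , q , q↭) = _ , walk-++ p q , ++⁺ p↭ (↭-prep _ q↭)

  path-source : Path G u xs v → u ∈ V G
  path-source (_ , p , _) = walk-source p

  path-first : Path G u xs v → ∃[ x ] Adj G u x × (xs ≡ [] × x ≡ v ⊎ x ∈ˡ xs)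
  path-first (_ , edge e , []↭xs) = _ , e , inj₁ (↭-empty-inv (↭-sym []↭xs) , refl)
  path-first (_ , _∷_ {x = x} e p , ys↭xs) = x , e , inj₂ (∈-resp-↭ ys↭xs (here refl))

  path-split : x ∈ˡ xs → Path G u xs v →
               ∃₂ λ as bs → xs ↭ x ∷ as ++ bs × Path G u as x × Path G x bs v
  path-split x∈xs (ys , p , ys↭)
    with as , bs , refl ← ∈-∃++ (∈-resp-↭ (↭-sym ys↭) x∈xs)
    with p₁ , p₂ ← walk-split as p =
    as , bs , ↭-trans (↭-sym ys↭) (shift _ as bs) ,
    (as , p₁ , ↭-refl) , (bs , p₂ , ↭-refl)

  path-inner⊆V : x ∈ˡ xs → Path G u xs v → x ∈ V G
  path-inner⊆V x∈xs p with _ , _ , _ , _ , q ← path-split x∈xs p = path-source q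

  path-suffix : x ∈ˡ u ∷ xs → Path G u xs v →
                ∃₂ λ as bs → u ∷ xs ↭ x ∷ as ++ bs × Path G x bs v
  path-suffix {u = u} {xs = xs} (here refl)  p = [] , xs , ↭-refl , p
  path-suffix {u = u} (there x∈) p with as , bs , xs↭ , _ , q ← path-split x∈ p =
    u ∷ as , bs , ↭-trans (↭-prep u xs↭) (shift _ [ u ] (as ++ bs)) , q

-- Linking two vertex sets in a 3-connected graph.

module _ (G : Graph m) where

  private
    _∈ˡ?_ = DecMembership._∈?_ (_≟_ {m})

  ∖-Adj : ∀ {S} → Adj (G ∖ S) u v → Adj G u v × u ∉ S
  ∖-Adj {u = u} {S = S} e with u ∈? S
  ... | yes _   = contradiction e ∉⊥
  ... | no  u∉S = p─q⊆p (N G u) S e , u∉S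

  module _ (G3 : ThreeConnected G) where

    private
      module _ {s t : Fin m} (A B : List (Fin m)) (uniq : Unique (s ∷ t ∷ A ++ B)) where

        S : Subset m
        S = ⁅ s ⁆ ∪ ⁅ t ⁆

        K : List (Fin m)
        K = s ∷ t ∷ A ++ B

        Crossing : Set
        Crossing = ∃₂ λ x y → ∃[ l ]
          x ∈ˡ A × y ∈ˡ B × Path G x l y × Unique (K ++ l)

        -- The start `u` is left unconstrained and may recur in `l`; `extend` removes such a loop
        -- when `u` becomes an internal vertex.
        Tail : Fin m → Set
        Tail u = ∃₂ λ y l → y ∈ˡ B × Walk G u l y × Unique l × All (_∉ˡ K) l

        ∉S : u ∉ S → ¬ (u ∈ˡ A) → ¬ (u ∈ˡ B) → u ∉ˡ K
        ∉S u∉S u∉A u∉B (here refl)         = u∉S (x∈p∪q⁺ (inj₁ (x∈⁅x⁆ _)))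
        ∉S u∉S u∉A u∉B (there (here refl)) = u∉S (x∈p∪q⁺ (inj₂ (x∈⁅x⁆ _)))
        ∉S u∉S u∉A u∉B (there (there u∈)) with ∈-++⁻ A u∈
        ... | inj₁ u∈A = u∉A u∈A
        ... | inj₂ u∈B = u∉B u∈B

        extend : Adj G u v → v ∉ˡ K → Tail v → Tail u
        extend {v = v} e v∉K (y , l , y∈B , p , ul , l∉K) with v ∈ˡ? l
        ... | no v∉l  = y , v ∷ l , y∈B , e ∷ p ,
                        All.¬Any⇒All¬ l v∉l ∷ ul , v∉K ∷ l∉K
        -- The tail returns to `v`, so only the part after that visit is kept.
        ... | yes v∈l with as , bs , refl ← ∈-∃++ v∈l =
          y , v ∷ bs , y∈B , e ∷ proj₂ (walk-split as p) ,
          Unique-++ʳ as ul , All.++⁻ʳ as l∉K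

        -- The walk is read from its end, so at each vertex the path to the next vertex of `B` is
        -- already known. It restarts at every vertex of `B`, and the first vertex of `A` met
        -- completes a crossing.
        scan : Star (Adj (G ∖ S)) u w → w ∈ˡ B → Crossing ⊎ u ∈ˡ B ⊎ Tail u
        scan ε w∈B = inj₂ (inj₁ w∈B)
        scan (_◅_ {j = v} e p) w∈B with scan p w∈B
        ... | inj₁ found      = inj₁ found
        ... | inj₂ (inj₁ v∈B) = inj₂ (inj₂ (v , [] , v∈B , edge (proj₁ (∖-Adj e)) , [] , []))
        ... | inj₂ (inj₂ tail@(y , l , y∈B , q , ul , l∉K)) with v ∈ˡ? A | v ∈ˡ? B
        ...   | yes v∈A | _ = inj₁ (v , y , l , v∈A , y∈B , (l , q , ↭-refl) , Unique-++-all uniq ul l∉K)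
        ...   | no _    | yes v∈B = inj₂ (inj₂ (v , [] , v∈B , edge (proj₁ (∖-Adj e)) , [] , []))
        ...   | no v∉A  | no v∉B  = inj₂ (inj₂ (extend (proj₁ (∖-Adj e))
                (∉S (proj₂ (∖-Adj {S = S} (N-sym (G ∖ S) e))) v∉A v∉B) tail))

    -- A walk from `u` to `w` survives the deletion of `s` and `t`; the stretch from its last vertex
    -- in `A` to the next one in `B` gives the path. The connectivity half of `ThreeConnected` is
    -- used only through this lemma. Uniqueness of the whole list allows the path to be added to any
    -- configuration built on `s`, `t`, `A` and `B`.
    crossing : s ∈ V G → t ∈ V G → ∀ A B → u ∈ˡ A → w ∈ˡ B → u ∈ V G → w ∈ V G →
               Unique (s ∷ t ∷ A ++ B) →
               ∃₂ λ x y → ∃[ l ]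
                 x ∈ˡ A × y ∈ˡ B × Path G x l y × Unique ((s ∷ t ∷ A ++ B) ++ l)
    crossing {s} {t} {u} {w} s∈V t∈V A B u∈A w∈B u∈V w∈V uniq@((s≢t ∷ s∉) ∷ (t∉ ∷ uAB))
      with scan A B uniq (proj₂ G3 s∈V t∈V s≢t (in-∖ u∈V (∈-++⁺ˡ u∈A)) (in-∖ w∈V (∈-++⁺ʳ A w∈B))) w∈B
      where
      in-∖ : ∀ {z} → z ∈ V G → z ∈ˡ A ++ B → z ∈ V (G ∖ (⁅ s ⁆ ∪ ⁅ t ⁆))
      in-∖ {z} z∈V z∈AB = x∈p∧x∉q⇒x∈p─q z∈V λ z∈S → case (x∈p∪q⁻ ⁅ s ⁆ ⁅ t ⁆ z∈S)
        where
        case : ¬ (z ∈ ⁅ s ⁆ ⊎ z ∈ ⁅ t ⁆)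
        case (inj₁ z∈) = All.lookup s∉ z∈AB (sym (x∈⁅y⁆⇒x≡y s z∈))
        case (inj₂ z∈) = All.lookup t∉ z∈AB (sym (x∈⁅y⁆⇒x≡y t z∈))
    ... | inj₁ found = found
    ... | inj₂ (inj₁ u∈B) = contradiction u∈B (Unique-++⇒∉ A uAB u∈A)
    ... | inj₂ (inj₂ (y , l , y∈B , p , ul , l∉K)) =
      u , y , l , u∈A , y∈B , (l , p , ↭-refl) , Unique-++-all uniq ul l∉K

-- Concatenation is commutative up to `↭`. The monoid solver thus supplies the rearrangements that
-- turn the repetition-free list of one configuration into that of another.
++-commutativeMonoid : Set → CommutativeMonoid _ _
++-commutativeMonoid A = record { isCommutativeMonoid = ++-isCommutativeMonoid {A = A} }

-- Subdivisions of K₄ inside J and their long paths.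

module Tetrahedra {m : ℕ} (J : Graph m) (Short : Fin m → Fin m → Set)
                  (short? : ∀ u v → Dec (Short u v))
                  (short-sym : ∀ u v → Short u v → Short v u) where

  open CommutativeMonoidSolver (++-commutativeMonoid (Fin m))
    using (id; solve; _⊕_; _⊜_)

  -- `Short` stands for the edges of `J` that remain single edges in `H`, so a path is long exactly
  -- when its image in `H` has an internal vertex.
  Long : Fin m → List (Fin m) → Fin m → Set
  Long u xs v = xs ≢ [] ⊎ ¬ Short u v

  ShortEdge : Fin m → Fin m → Set
  ShortEdge u v = Adj J u v × Short u v

  long-sym : ∀ {u xs v} → Long u xs v → Long v xs u
  long-sym (inj₁ xs≢[]) = inj₁ xs≢[]
  long-sym (inj₂ ¬s)    = inj₂ (¬s ∘ short-sym _ _)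

  long-∷ : ∀ {u v x} xs {ys} → Long u (xs ++ x ∷ ys) v
  long-∷ xs = inj₁ (++∷≢[] xs)

  shortEdge-sym : ∀ {u v} → ShortEdge u v → ShortEdge v u
  shortEdge-sym (e , s) = N-sym J e , short-sym _ _ s

  short-path : ∀ {u v} → ShortEdge u v → Path J u [] v
  short-path = path-edge ∘ proj₁

  long? : ∀ {u xs v} → Path J u xs v → Long u xs v ⊎ (xs ≡ [] × ShortEdge u v)
  long? {u} {[]}    {v} p with short? u v
  ... | yes s = inj₂ (refl , path-adj p , s)
  ... | no ¬s = inj₁ (inj₂ ¬s)
  long? {u} {_ ∷ _} {v} p = inj₁ (inj₁ λ ())

  -- A subdivision of K₄ with corners `a`, `b`, `c`, `d`. The single list in `unique` encodes at
  -- once that the corners are distinct, that the paths do not repeat vertices, and that they meet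
  -- only at corners.
  record Tetra (a b c d : Fin m) (ab ac ad bc bd cd : List (Fin m)) : Set where
    constructor tetra
    field
      path-ab : Path J a ab b
      path-ac : Path J a ac c
      path-ad : Path J a ad d
      path-bc : Path J b bc c
      path-bd : Path J b bd d
      path-cd : Path J c cd d
      unique  : Unique (a ∷ b ∷ c ∷ d ∷ ab ++ ac ++ ad ++ bc ++ bd ++ cd)

  -- The three adjacent transpositions generate all permutations of the corners, so any two long
  -- paths with a common end can be moved to the positions `ab` and `ac`.
  swap₁₂ : Tetra a b c d ab ac ad bc bd cd → Tetra b a c d ab bc bd ac ad cd
  swap₁₂ {a} {b} {c} {d} {ab} {ac} {ad} {bc} {bd} {cd} (tetra p q r s t u uniq) =
    tetra (path-sym p) s t q r u (Unique-resp-↭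
      (solve 10 (λ a b c d ab ac ad bc bd cd →
        a ⊕ b ⊕ c ⊕ d ⊕ ab ⊕ ac ⊕ ad ⊕ bc ⊕ bd ⊕ cd ⊜
        b ⊕ a ⊕ c ⊕ d ⊕ ab ⊕ bc ⊕ bd ⊕ ac ⊕ ad ⊕ cd) ↭-refl
        [ a ] [ b ] [ c ] [ d ] ab ac ad bc bd cd) uniq)

  swap₂₃ : Tetra a b c d ab ac ad bc bd cd → Tetra a c b d ac ab ad bc cd bd
  swap₂₃ {a} {b} {c} {d} {ab} {ac} {ad} {bc} {bd} {cd} (tetra p q r s t u uniq) =
    tetra q p r (path-sym s) u t (Unique-resp-↭
      (solve 10 (λ a b c d ab ac ad bc bd cd →
        a ⊕ b ⊕ c ⊕ d ⊕ ab ⊕ ac ⊕ ad ⊕ bc ⊕ bd ⊕ cd ⊜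
        a ⊕ c ⊕ b ⊕ d ⊕ ac ⊕ ab ⊕ ad ⊕ bc ⊕ cd ⊕ bd) ↭-refl
        [ a ] [ b ] [ c ] [ d ] ab ac ad bc bd cd) uniq)

  swap₃₄ : Tetra a b c d ab ac ad bc bd cd → Tetra a b d c ab ad ac bd bc cd
  swap₃₄ {a} {b} {c} {d} {ab} {ac} {ad} {bc} {bd} {cd} (tetra p q r s t u uniq) =
    tetra p r q t s (path-sym u) (Unique-resp-↭
      (solve 10 (λ a b c d ab ac ad bc bd cd →
        a ⊕ b ⊕ c ⊕ d ⊕ ab ⊕ ac ⊕ ad ⊕ bc ⊕ bd ⊕ cd ⊜
        a ⊕ b ⊕ d ⊕ c ⊕ ab ⊕ ad ⊕ ac ⊕ bd ⊕ bc ⊕ cd) ↭-refl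
        [ a ] [ b ] [ c ] [ d ] ab ac ad bc bd cd) uniq)

  record LongTetra : Set where
    constructor longTetra
    field
      {a′ b′ c′ d′}              : Fin m
      {ab′ ac′ ad′ bc′ bd′ cd′} : List (Fin m)
      tetra-abcd : Tetra a′ b′ c′ d′ ab′ ac′ ad′ bc′ bd′ cd′
      long-ab    : Long a′ ab′ b′
      long-ac    : Long a′ ac′ c′

  record Square (a b c d : Fin m) (P Q : List (Fin m)) : Set where
    constructor square
    field
      edge-ab : ShortEdge a b
      edge-bc : ShortEdge b c
      edge-cd : ShortEdge c d
      edge-da : ShortEdge d a
      path-P  : Path J a P c
      path-Q  : Path J b Q d
      long-P  : Long a P c
      long-Q  : Long b Q d
      unique  : Unique (P ++ Q ++ a ∷ b ∷ c ∷ d ∷ [])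

  SomeSquare : Set
  SomeSquare = ∃₂ λ a b → ∃₂ λ c d → ∃₂ λ P Q → Square a b c d P Q

  square-rotate : Square a b c d P Q → Square b c d a Q P
  square-rotate {a} {b} {c} {d} {P} {Q} (square ab bc cd da p q lp lq uniq) =
    square bc cd da ab q (path-sym p) lq (long-sym lp) (Unique-resp-↭
      (solve 6 (λ a b c d P Q → P ⊕ Q ⊕ a ⊕ b ⊕ c ⊕ d ⊕ id ⊜ Q ⊕ P ⊕ b ⊕ c ⊕ d ⊕ a ⊕ id)
        ↭-refl [ a ] [ b ] [ c ] [ d ] P Q) uniq)

  square-flip : Square a b c d P Q → Square a d c b P Q
  square-flip {a} {b} {c} {d} {P} {Q} (square ab bc cd da p q lp lq uniq) =
    square (shortEdge-sym da) (shortEdge-sym cd) (shortEdge-sym bc) (shortEdge-sym ab)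
      p (path-sym q) lp (long-sym lq) (Unique-resp-↭
      (solve 6 (λ a b c d P Q → P ⊕ Q ⊕ a ⊕ b ⊕ c ⊕ d ⊕ id ⊜ P ⊕ Q ⊕ a ⊕ d ⊕ c ⊕ b ⊕ id)
        ↭-refl [ a ] [ b ] [ c ] [ d ] P Q) uniq)

  module _ (no-short-triangle : ∀ {u v w} → ShortEdge u v → ShortEdge v w → ¬ ShortEdge u w) where

    private
      -- The four paths that share an end with `ab` must be short edges, since otherwise two long
      -- paths meet. The triangle `a`, `c`, `d` then forces `cd` to be long, and `ab` and `cd` are
      -- the diagonals of a square.
      classify-long : Tetra a b c d ab ac ad bc bd cd → Long a ab b → LongTetra ⊎ SomeSquare
      classify-long {a} {b} {c} {d} {ab} {cd = cd} T@(tetra p q r s t u uniq) l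
        with long? q | long? r | long? s | long? t
      ... | inj₁ lq | _ | _ | _ = inj₁ (longTetra T l lq)
      ... | _ | inj₁ lr | _ | _ = inj₁ (longTetra (swap₃₄ T) l lr)
      ... | _ | _ | inj₁ ls | _ = inj₁ (longTetra (swap₁₂ T) (long-sym l) ls)
      ... | _ | _ | _ | inj₁ lt = inj₁ (longTetra (swap₃₄ (swap₁₂ T)) (long-sym l) lt)
      ... | inj₂ (refl , e-ac) | inj₂ (refl , e-ad) | inj₂ (refl , e-bc) | inj₂ (refl , e-bd)
        with long? u
      ... | inj₂ (_ , e-cd) = contradiction e-ad (no-short-triangle e-ac e-cd)
      ... | inj₁ lu = inj₂ (a , c , b , d , ab , cd ,
        square e-ac (shortEdge-sym e-bc) e-bd (shortEdge-sym e-ad) p u l lu (Unique-resp-↭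
          (solve 6 (λ a b c d ab cd → a ⊕ b ⊕ c ⊕ d ⊕ ab ⊕ cd ⊜ ab ⊕ cd ⊕ a ⊕ c ⊕ b ⊕ d ⊕ id)
            ↭-refl [ a ] [ b ] [ c ] [ d ] ab cd) uniq))

    -- One side of the triangle `a`, `b`, `c` is long; a permutation of the corners makes it `ab`.
    classify : Tetra a b c d ab ac ad bc bd cd → LongTetra ⊎ SomeSquare
    classify T@(tetra p q r s t u uniq) with long? p | long? q | long? s
    ... | inj₁ lp | _ | _ = classify-long T lp
    ... | _ | inj₁ lq | _ = classify-long (swap₂₃ T) lq
    ... | _ | _ | inj₁ ls = classify-long (swap₂₃ (swap₁₂ T)) ls
    ... | inj₂ (_ , e-ab) | inj₂ (_ , e-ac) | inj₂ (_ , e-bc) =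
      contradiction e-ac (no-short-triangle e-ab e-bc)

  -- Drop the edge from `a` to `b` and take the corners `d`, `x`, `b`, `c`. Now `a` is internal to
  -- the path from `d` to `x`, and `Q` is a second long path at `d`.
  square-with-triangle : Square a b c d P Q → Path J a P₁ x → Path J x P₂ c → Path J x R b →
                         Unique ((x ∷ P₁ ++ P₂) ++ Q ++ a ∷ b ∷ c ∷ d ∷ R) → LongTetra
  square-with-triangle {a} {b} {c} {d} {P} {Q} {P₁} {x} {P₂} {R}
    (square ab bc cd da _ q _ lq _) p₁ p₂ r uniq =
    longTetra
      (tetra (path-sym (path-++ (path-sym p₁) (short-path (shortEdge-sym da))))
        (path-sym q) (short-path (shortEdge-sym cd)) r p₂ (short-path bc)
        (Unique-drop
          (solve 9 (λ a b c d x P₁ P₂ Q R →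
            (x ⊕ P₁ ⊕ P₂) ⊕ Q ⊕ a ⊕ b ⊕ c ⊕ d ⊕ R ⊜
            (d ⊕ x ⊕ b ⊕ c ⊕ (P₁ ⊕ a ⊕ id) ⊕ Q ⊕ R ⊕ P₂ ⊕ id) ⊕ id)
            ↭-refl [ a ] [ b ] [ c ] [ d ] [ x ] P₁ P₂ Q R) uniq))
      (long-∷ P₁) (long-sym lq)

  -- `R` replaces the edge from `a` to `b`, so that `R` and `P` are long paths leaving `a`.
  square-with-parallel : Square a b c d P Q → Path J a R b → R ≢ [] →
                         Unique (P ++ Q ++ a ∷ b ∷ c ∷ d ∷ R) → LongTetra
  square-with-parallel {a} {b} {c} {d} {P} {Q} {R} (square ab bc cd da p q lp lq _) r R≢[] uniq =
    longTetra
      (tetra r p (short-path (shortEdge-sym da)) (short-path bc) q (short-path cd)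
        (Unique-resp-↭
          (solve 7 (λ a b c d P Q R →
            P ⊕ Q ⊕ a ⊕ b ⊕ c ⊕ d ⊕ R ⊜ a ⊕ b ⊕ c ⊕ d ⊕ R ⊕ P ⊕ Q ⊕ id)
            ↭-refl [ a ] [ b ] [ c ] [ d ] P Q R) uniq))
      (inj₁ R≢[]) lp

  -- Copies and subdivisions of K₃,₃ inside J.

  record K₃₃ (a₁ a₂ a₃ b₁ b₂ b₃ : Fin m) : Set where
    constructor k₃₃
    field
      e₁₁ : ShortEdge a₁ b₁
      e₁₂ : ShortEdge a₁ b₂
      e₁₃ : ShortEdge a₁ b₃
      e₂₁ : ShortEdge a₂ b₁
      e₂₂ : ShortEdge a₂ b₂
      e₂₃ : ShortEdge a₂ b₃
      e₃₁ : ShortEdge a₃ b₁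
      e₃₂ : ShortEdge a₃ b₂
      e₃₃ : ShortEdge a₃ b₃
      unique : Unique (a₁ ∷ a₂ ∷ a₃ ∷ b₁ ∷ b₂ ∷ b₃ ∷ [])

  -- A subdivision of K₃,₃ with sides a, c, y and b, d, x.
  record Hexagon (a b c d x y : Fin m) (P₁ P₂ Q₁ Q₂ R : List (Fin m)) : Set where
    constructor hexagon
    field
      edge-ab : ShortEdge a b
      edge-bc : ShortEdge b c
      edge-cd : ShortEdge c d
      edge-da : ShortEdge d a
      path-P₁ : Path J a P₁ x
      path-P₂ : Path J x P₂ c
      path-Q₁ : Path J b Q₁ y
      path-Q₂ : Path J y Q₂ d
      path-R  : Path J x R y
      unique  : Unique ((x ∷ P₁ ++ P₂) ++ (y ∷ Q₁ ++ Q₂) ++ a ∷ b ∷ c ∷ d ∷ R)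

  -- Together with `hexagon-rotate` this symmetry brings each of `P₁`, `Q₁` and `Q₂` to the position
  -- of `P₂`.
  hexagon-flip : Hexagon a b c d x y P₁ P₂ Q₁ Q₂ R → Hexagon c b a d x y P₂ P₁ Q₁ Q₂ R
  hexagon-flip {a} {b} {c} {d} {x} {y} {P₁} {P₂} {Q₁} {Q₂} {R}
    (hexagon ab bc cd da p₁ p₂ q₁ q₂ r uniq) =
    hexagon (shortEdge-sym bc) (shortEdge-sym ab) (shortEdge-sym da) (shortEdge-sym cd)
      (path-sym p₂) (path-sym p₁) q₁ q₂ r (Unique-resp-↭
        (solve 11 (λ a b c d x y P₁ P₂ Q₁ Q₂ R →
          (x ⊕ P₁ ⊕ P₂) ⊕ (y ⊕ Q₁ ⊕ Q₂) ⊕ a ⊕ b ⊕ c ⊕ d ⊕ R ⊜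
          (x ⊕ P₂ ⊕ P₁) ⊕ (y ⊕ Q₁ ⊕ Q₂) ⊕ c ⊕ b ⊕ a ⊕ d ⊕ R) ↭-refl
          [ a ] [ b ] [ c ] [ d ] [ x ] [ y ] P₁ P₂ Q₁ Q₂ R) uniq)

  hexagon-rotate : Hexagon a b c d x y P₁ P₂ Q₁ Q₂ R → Hexagon b c d a y x Q₁ Q₂ P₂ P₁ R
  hexagon-rotate {a} {b} {c} {d} {x} {y} {P₁} {P₂} {Q₁} {Q₂} {R}
    (hexagon ab bc cd da p₁ p₂ q₁ q₂ r uniq) =
    hexagon bc cd da ab q₁ q₂ (path-sym p₂) (path-sym p₁) (path-sym r) (Unique-resp-↭
        (solve 11 (λ a b c d x y P₁ P₂ Q₁ Q₂ R →
          (x ⊕ P₁ ⊕ P₂) ⊕ (y ⊕ Q₁ ⊕ Q₂) ⊕ a ⊕ b ⊕ c ⊕ d ⊕ R ⊜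
          (y ⊕ Q₁ ⊕ Q₂) ⊕ (x ⊕ P₂ ⊕ P₁) ⊕ b ⊕ c ⊕ d ⊕ a ⊕ R) ↭-refl
          [ a ] [ b ] [ c ] [ d ] [ x ] [ y ] P₁ P₂ Q₁ Q₂ R) uniq)

  -- Delete the edge ab.
  hexagon-tetra : Hexagon a b c d x y P₁ P₂ Q₁ Q₂ R →
                  Tetra x d y c (P₁ ++ [ a ]) R P₂ Q₂ [] (Q₁ ++ [ b ])
  hexagon-tetra {a} {b} {c} {d} {x} {y} {P₁} {P₂} {Q₁} {Q₂} {R}
    (hexagon ab bc cd da p₁ p₂ q₁ q₂ r uniq) =
    tetra (path-++ (path-sym p₁) (short-path (shortEdge-sym da))) r p₂
      (path-sym q₂) (short-path (shortEdge-sym cd)) (path-++ (path-sym q₁) (short-path bc))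
      (Unique-resp-↭
        (solve 11 (λ a b c d x y P₁ P₂ Q₁ Q₂ R →
          (x ⊕ P₁ ⊕ P₂) ⊕ (y ⊕ Q₁ ⊕ Q₂) ⊕ a ⊕ b ⊕ c ⊕ d ⊕ R ⊜
          x ⊕ d ⊕ y ⊕ c ⊕ (P₁ ⊕ a) ⊕ R ⊕ P₂ ⊕ Q₂ ⊕ (Q₁ ⊕ b)) ↭-refl
          [ a ] [ b ] [ c ] [ d ] [ x ] [ y ] P₁ P₂ Q₁ Q₂ R) uniq)

  -- After the deletion of the edge `ab` the path from `x` through `a` is long, so one more long
  -- path at `x` is enough.
  hexagon-long-P₂ : Hexagon a b c d x y P₁ P₂ Q₁ Q₂ R → Long x P₂ c → LongTetra
  hexagon-long-P₂ {P₁ = P₁} H l = longTetra (swap₃₄ (hexagon-tetra H)) (long-∷ P₁) l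

  -- A long `R` also leaves `x`, next to the long path through `a`; the other four paths are
  -- symmetric to `P₂`. If all five are short edges, they complete the 4-cycle to the nine edges of
  -- K₃,₃.
  hexagon-K₃₃ : Hexagon a b c d x y P₁ P₂ Q₁ Q₂ R → LongTetra ⊎ K₃₃ a c y b d x
  hexagon-K₃₃ {a} {b} {c} {d} {x} {y} {P₁} H@(hexagon ab bc cd da p₁ p₂ q₁ q₂ r uniq)
    with long? r | long? p₁ | long? p₂ | long? q₁ | long? q₂
  ... | inj₁ l | _ | _ | _ | _ = inj₁ (longTetra (hexagon-tetra H) (long-∷ P₁) l)
  ... | _ | inj₁ l | _ | _ | _ = inj₁ (hexagon-long-P₂ (hexagon-flip H) (long-sym l))
  ... | _ | _ | inj₁ l | _ | _ = inj₁ (hexagon-long-P₂ H l)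
  ... | _ | _ | _ | inj₁ l | _ = inj₁ (hexagon-long-P₂ (hexagon-flip (hexagon-rotate H)) (long-sym l))
  ... | _ | _ | _ | _ | inj₁ l = inj₁ (hexagon-long-P₂ (hexagon-rotate H) l)
  ... | inj₂ (refl , xy) | inj₂ (refl , ax) | inj₂ (refl , xc) | inj₂ (refl , by) | inj₂ (refl , yd) =
    inj₂ (k₃₃ ab (shortEdge-sym da) ax (shortEdge-sym bc) cd (shortEdge-sym xc)
      (shortEdge-sym by) yd (shortEdge-sym xy)
      (Unique-resp-↭
        (solve 6 (λ a b c d x y →
          x ⊕ y ⊕ a ⊕ b ⊕ c ⊕ d ⊕ id ⊜ a ⊕ c ⊕ y ⊕ b ⊕ d ⊕ x ⊕ id) ↭-refl
          [ a ] [ b ] [ c ] [ d ] [ x ] [ y ]) uniq))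

  K₃₃-swap₁₂ : K₃₃ a₁ a₂ a₃ b₁ b₂ b₃ → K₃₃ a₂ a₁ a₃ b₁ b₂ b₃
  K₃₃-swap₁₂ {a₁} {a₂} {a₃} {b₁} {b₂} {b₃} (k₃₃ e₁₁ e₁₂ e₁₃ e₂₁ e₂₂ e₂₃ e₃₁ e₃₂ e₃₃ uniq) =
    k₃₃ e₂₁ e₂₂ e₂₃ e₁₁ e₁₂ e₁₃ e₃₁ e₃₂ e₃₃ (Unique-resp-↭
      (solve 3 (λ a₁ a₂ w → a₁ ⊕ a₂ ⊕ w ⊜ a₂ ⊕ a₁ ⊕ w) ↭-refl
        [ a₁ ] [ a₂ ] (a₃ ∷ b₁ ∷ b₂ ∷ b₃ ∷ [])) uniq)

  K₃₃-swap₂₃ : K₃₃ a₁ a₂ a₃ b₁ b₂ b₃ → K₃₃ a₁ a₃ a₂ b₁ b₂ b₃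
  K₃₃-swap₂₃ {a₁} {a₂} {a₃} {b₁} {b₂} {b₃} (k₃₃ e₁₁ e₁₂ e₁₃ e₂₁ e₂₂ e₂₃ e₃₁ e₃₂ e₃₃ uniq) =
    k₃₃ e₁₁ e₁₂ e₁₃ e₃₁ e₃₂ e₃₃ e₂₁ e₂₂ e₂₃ (Unique-resp-↭
      (solve 4 (λ a₁ a₂ a₃ w → a₁ ⊕ a₂ ⊕ a₃ ⊕ w ⊜ a₁ ⊕ a₃ ⊕ a₂ ⊕ w) ↭-refl
        [ a₁ ] [ a₂ ] [ a₃ ] (b₁ ∷ b₂ ∷ b₃ ∷ [])) uniq)

  K₃₃-transpose : K₃₃ a₁ a₂ a₃ b₁ b₂ b₃ → K₃₃ b₁ b₂ b₃ a₁ a₂ a₃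
  K₃₃-transpose {a₁} {a₂} {a₃} {b₁} {b₂} {b₃} (k₃₃ e₁₁ e₁₂ e₁₃ e₂₁ e₂₂ e₂₃ e₃₁ e₃₂ e₃₃ uniq) =
    k₃₃ (shortEdge-sym e₁₁) (shortEdge-sym e₂₁) (shortEdge-sym e₃₁)
        (shortEdge-sym e₁₂) (shortEdge-sym e₂₂) (shortEdge-sym e₃₂)
        (shortEdge-sym e₁₃) (shortEdge-sym e₂₃) (shortEdge-sym e₃₃)
        (Unique-resp-↭ (++-comm (a₁ ∷ a₂ ∷ a₃ ∷ []) (b₁ ∷ b₂ ∷ b₃ ∷ [])) uniq)

  -- Branch vertices a₃, a₁, a₂, b₁; the vertices b₂ and b₃ become internal.
  K₃₃-same-side : K₃₃ a₁ a₂ a₃ b₁ b₂ b₃ → Path J a₁ R a₂ →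
                  Unique (R ++ a₁ ∷ a₂ ∷ a₃ ∷ b₁ ∷ b₂ ∷ b₃ ∷ []) → LongTetra
  K₃₃-same-side {a₁} {a₂} {a₃} {b₁} {b₂} {b₃} {R}
    (k₃₃ e₁₁ e₁₂ e₁₃ e₂₁ e₂₂ e₂₃ e₃₁ e₃₂ e₃₃ _) r uniq =
    longTetra
      (tetra (path-++ (short-path e₃₂) (short-path (shortEdge-sym e₁₂)))
             (path-++ (short-path e₃₃) (short-path (shortEdge-sym e₂₃)))
             (short-path e₃₁) r (short-path e₁₁) (short-path e₂₁)
             (Unique-resp-↭
               (solve 7 (λ a₁ a₂ a₃ b₁ b₂ b₃ R →
                 R ⊕ a₁ ⊕ a₂ ⊕ a₃ ⊕ b₁ ⊕ b₂ ⊕ b₃ ⊕ id ⊜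
                 a₃ ⊕ a₁ ⊕ a₂ ⊕ b₁ ⊕ b₂ ⊕ b₃ ⊕ R ⊕ id) ↭-refl
                 [ a₁ ] [ a₂ ] [ a₃ ] [ b₁ ] [ b₂ ] [ b₃ ] R) uniq))
      (long-∷ []) (long-∷ [])

  -- `R` replaces the edge from `a₁` to `b₁`. The corners are `a₁`, `b₁`, `a₂`, `b₂`; the vertex
  -- `b₃` becomes internal between `a₁` and `a₂`, and `a₃` between `b₁` and `b₂`. Two long paths
  -- leave `a₁`.
  K₃₃-opposite-sides : K₃₃ a₁ a₂ a₃ b₁ b₂ b₃ → Path J a₁ R b₁ → R ≢ [] →
                       Unique (R ++ a₁ ∷ a₂ ∷ a₃ ∷ b₁ ∷ b₂ ∷ b₃ ∷ []) → LongTetra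
  K₃₃-opposite-sides {a₁} {a₂} {a₃} {b₁} {b₂} {b₃} {R}
    (k₃₃ e₁₁ e₁₂ e₁₃ e₂₁ e₂₂ e₂₃ e₃₁ e₃₂ e₃₃ _) r R≢[] uniq =
    longTetra
      (tetra r (path-++ (short-path e₁₃) (short-path (shortEdge-sym e₂₃))) (short-path e₁₂)
        (short-path (shortEdge-sym e₂₁))
        (path-++ (short-path (shortEdge-sym e₃₁)) (short-path e₃₂)) (short-path e₂₂)
        (Unique-resp-↭
          (solve 7 (λ a₁ a₂ a₃ b₁ b₂ b₃ R →
            R ⊕ a₁ ⊕ a₂ ⊕ a₃ ⊕ b₁ ⊕ b₂ ⊕ b₃ ⊕ id ⊜
            a₁ ⊕ b₁ ⊕ a₂ ⊕ b₂ ⊕ R ⊕ b₃ ⊕ a₃ ⊕ id) ↭-refl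
            [ a₁ ] [ a₂ ] [ a₃ ] [ b₁ ] [ b₂ ] [ b₃ ] R) uniq))
      (inj₁ R≢[]) (long-∷ [])

  K₃₃-attach : K₃₃ a₁ a₂ a₃ b₁ b₂ b₃ → y ∈ˡ (a₂ ∷ a₃ ∷ b₁ ∷ b₂ ∷ b₃ ∷ []) →
               Path J a₁ R y → R ≢ [] →
               Unique (R ++ a₁ ∷ a₂ ∷ a₃ ∷ b₁ ∷ b₂ ∷ b₃ ∷ []) → LongTetra
  K₃₃-attach {a₁} {a₂} {a₃} {b₁} {b₂} {b₃} {y} {R} K y∈ r R≢[] uniq with y∈
  ... | here refl = K₃₃-same-side K r uniq
  ... | there (here refl) = K₃₃-same-side (K₃₃-swap₂₃ K) r (Unique-resp-↭
    (solve 5 (λ R a₁ a₂ a₃ w → R ⊕ a₁ ⊕ a₂ ⊕ a₃ ⊕ w ⊜ R ⊕ a₁ ⊕ a₃ ⊕ a₂ ⊕ w) ↭-refl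
      R [ a₁ ] [ a₂ ] [ a₃ ] (b₁ ∷ b₂ ∷ b₃ ∷ [])) uniq)
  ... | there (there (here refl)) = K₃₃-opposite-sides K r R≢[] uniq
  ... | there (there (there (here refl))) =
    K₃₃-opposite-sides (K₃₃-transpose (K₃₃-swap₁₂ (K₃₃-transpose K))) r R≢[] (Unique-resp-↭
    (solve 5 (λ R w b₁ b₂ b₃ → R ⊕ w ⊕ b₁ ⊕ b₂ ⊕ b₃ ⊕ id ⊜ R ⊕ w ⊕ b₂ ⊕ b₁ ⊕ b₃ ⊕ id) ↭-refl
      R (a₁ ∷ a₂ ∷ a₃ ∷ []) [ b₁ ] [ b₂ ] [ b₃ ]) uniq)
  ... | there (there (there (there (here refl)))) =
    K₃₃-opposite-sides (K₃₃-transpose (K₃₃-swap₁₂ (K₃₃-swap₂₃ (K₃₃-transpose K)))) r R≢[] (Unique-resp-↭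
    (solve 5 (λ R w b₁ b₂ b₃ → R ⊕ w ⊕ b₁ ⊕ b₂ ⊕ b₃ ⊕ id ⊜ R ⊕ w ⊕ b₃ ⊕ b₁ ⊕ b₂ ⊕ id) ↭-refl
      R (a₁ ∷ a₂ ∷ a₃ ∷ []) [ b₁ ] [ b₂ ] [ b₃ ]) uniq)

  K₃₃-reorder : K₃₃ a₁ a₂ a₃ b₁ b₂ b₃ → y ∈ˡ (a₁ ∷ a₂ ∷ a₃ ∷ b₁ ∷ b₂ ∷ b₃ ∷ []) →
                ∃₂ λ a₂′ a₃′ → ∃₂ λ b₁′ b₂′ → ∃ λ b₃′ →
                  K₃₃ y a₂′ a₃′ b₁′ b₂′ b₃′ ×
                  (a₁ ∷ a₂ ∷ a₃ ∷ b₁ ∷ b₂ ∷ b₃ ∷ [] ↭ y ∷ a₂′ ∷ a₃′ ∷ b₁′ ∷ b₂′ ∷ b₃′ ∷ [])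
  K₃₃-reorder {a₁} {a₂} {a₃} {b₁} {b₂} {b₃} K y∈ with y∈
  ... | here refl                 = _ , _ , _ , _ , _ , K , ↭-refl
  ... | there (here refl)         = _ , _ , _ , _ , _ , K₃₃-swap₁₂ K , shift a₂ [ a₁ ] _
  ... | there (there (here refl)) =
    _ , _ , _ , _ , _ , K₃₃-swap₁₂ (K₃₃-swap₂₃ K) , shift a₃ (a₁ ∷ a₂ ∷ []) _
  ... | there (there (there (here refl))) =
    _ , _ , _ , _ , _ , K₃₃-transpose K , ++-comm (a₁ ∷ a₂ ∷ a₃ ∷ []) (b₁ ∷ b₂ ∷ b₃ ∷ [])
  ... | there (there (there (there (here refl)))) =
    _ , _ , _ , _ , _ , K₃₃-swap₁₂ (K₃₃-transpose K) ,
    ↭-trans (++-comm (a₁ ∷ a₂ ∷ a₃ ∷ []) (b₁ ∷ b₂ ∷ b₃ ∷ [])) (shift b₂ [ b₁ ] _)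
  ... | there (there (there (there (there (here refl))))) =
    _ , _ , _ , _ , _ , K₃₃-swap₁₂ (K₃₃-swap₂₃ (K₃₃-transpose K)) ,
    ↭-trans (++-comm (a₁ ∷ a₂ ∷ a₃ ∷ []) (b₁ ∷ b₂ ∷ b₃ ∷ [])) (shift b₃ (b₁ ∷ b₂ ∷ []) _)

-- Counting: finding a vertex outside a given list.

∣p∪q∣≤∣p∣+∣q∣ : ∀ {n} (p q : Subset n) → ∣ p ∪ q ∣ ≤ⁿ ∣ p ∣ +ⁿ ∣ q ∣
∣p∪q∣≤∣p∣+∣q∣ []            []            = z≤n
∣p∪q∣≤∣p∣+∣q∣ (outside ∷ p) (outside ∷ q) = ∣p∪q∣≤∣p∣+∣q∣ p q
∣p∪q∣≤∣p∣+∣q∣ (outside ∷ p) (inside ∷ q)  =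
  ℕ.≤-trans (s≤s (∣p∪q∣≤∣p∣+∣q∣ p q)) (ℕ.≤-reflexive (sym (ℕ.+-suc ∣ p ∣ ∣ q ∣)))
∣p∪q∣≤∣p∣+∣q∣ (inside ∷ p)  (outside ∷ q) = s≤s (∣p∪q∣≤∣p∣+∣q∣ p q)
∣p∪q∣≤∣p∣+∣q∣ (inside ∷ p)  (inside ∷ q)  =
  s≤s (ℕ.≤-trans (∣p∪q∣≤∣p∣+∣q∣ p q) (ℕ.+-monoʳ-≤ ∣ p ∣ (ℕ.n≤1+n ∣ q ∣)))

⊆ˡ⇒∣p∣≤length : ∀ {n} (p : Subset n) xs → (∀ {x} → x ∈ p → x ∈ˡ xs) → ∣ p ∣ ≤ⁿ length xs
⊆ˡ⇒∣p∣≤length {n} p xs p⊆xs =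
  ℕ.≤-trans (p⊆q⇒∣p∣≤∣q∣ (λ x∈p → ∈-⋃ xs (p⊆xs x∈p))) (∣⋃∣≤ xs)
  where
  ∈-⋃ : ∀ {x : Fin n} xs → x ∈ˡ xs → x ∈ ⋃ (map ⁅_⁆ xs)
  ∈-⋃ (x ∷ xs) (here refl)  = x∈p∪q⁺ (inj₁ (x∈⁅x⁆ x))
  ∈-⋃ (_ ∷ xs) (there x∈xs) = x∈p∪q⁺ (inj₂ (∈-⋃ xs x∈xs))
  ∣⋃∣≤ : ∀ (xs : List (Fin n)) → ∣ ⋃ (map ⁅_⁆ xs) ∣ ≤ⁿ length xs
  ∣⋃∣≤ []       = ℕ.≤-reflexive (∣⊥∣≡0 n)
  ∣⋃∣≤ (x ∷ xs) = ℕ.≤-trans (∣p∪q∣≤∣p∣+∣q∣ ⁅ x ⁆ (⋃ (map ⁅_⁆ xs)))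
    (ℕ.+-mono-≤ (ℕ.≤-reflexive (∣⁅x⁆∣≡1 x)) (∣⋃∣≤ xs))

module _ {n} (p : Subset n) where

  private
    _∈ˡ?_ = DecMembership._∈?_ (_≟_ {n})

  outside-list? : ∀ xs → (∃[ x ] x ∈ p × x ∉ˡ xs) ⊎ (∀ {x} → x ∈ p → x ∈ˡ xs)
  outside-list? xs with any? (λ x → x ∈? p ×-dec ¬? (x ∈ˡ? xs))
  ... | yes found = inj₁ found
  ... | no ¬found = inj₂ λ {x} x∈p → decidable-stable (x ∈ˡ? xs) λ x∉xs → ¬found (x , x∈p , x∉xs)

  outside-list : ∀ xs → length xs <ⁿ ∣ p ∣ → ∃[ x ] x ∈ p × x ∉ˡ xs
  outside-list xs l<p with outside-list? xs
  ... | inj₁ found = found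
  ... | inj₂ p⊆xs  = contradiction (⊆ˡ⇒∣p∣≤length p xs p⊆xs) (ℕ.<⇒≱ l<p)

-- The possible shapes of a 3-connected graph without short triangles.

module _ {m : ℕ} (J : Graph m) (Short : Fin m → Fin m → Set)
         (short? : ∀ u v → Dec (Short u v))
         (short-sym : ∀ u v → Short u v → Short v u) where

  open Tetrahedra J Short short? short-sym
  open CommutativeMonoidSolver (++-commutativeMonoid (Fin m))
    using (id; solve; _⊕_; _⊜_)

  -- The last two constructors determine `J` completely. For K₃,₃ the non-adjacencies exclude edges
  -- within a side; in K₄ all pairs of vertices are adjacent already.
  data Outcome : Set where
    long-tetra : LongTetra → Outcome
    only-K₃₃   : K₃₃ a₁ a₂ a₃ b₁ b₂ b₃ →
                 (∀ {v} → v ∈ V J → v ∈ˡ a₁ ∷ a₂ ∷ a₃ ∷ b₁ ∷ b₂ ∷ b₃ ∷ []) →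
                 ¬ Adj J a₁ a₂ → ¬ Adj J a₁ a₃ → ¬ Adj J a₂ a₃ →
                 ¬ Adj J b₁ b₂ → ¬ Adj J b₁ b₃ → ¬ Adj J b₂ b₃ → Outcome
    only-K₄    : Tetra a b c d [] [] [] [] [] [] →
                 (∀ {v} → v ∈ V J → v ∈ˡ a ∷ b ∷ c ∷ d ∷ []) → Outcome

  module _ (J3 : ThreeConnected J)
           (no-short-triangle : ∀ {u v w} → ShortEdge u v → ShortEdge v w → ¬ ShortEdge u w) where

    private
      -- The corners are the ends `s`, `t` of the theta graph and the ends `x`, `y` of the crossing
      -- path. The arms `X` and `Y` are cut in two, and `Z` stays whole as the path from `s` to `t`.
      theta-with-crossing : ∀ {l} → Path J s X t → Path J s Y t → Path J s Z t →
        x ∈ˡ X → y ∈ˡ Y → Path J x l y → Unique (X ++ Y ++ s ∷ t ∷ Z ++ l) → LongTetra ⊎ SomeSquare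
      theta-with-crossing {s} {X} {t} {Y} {Z} {x} {y} {l} p q r x∈X y∈Y c uniq
        with X₁ , X₂ , X↭ , p₁ , p₂ ← path-split x∈X p
        with Y₁ , Y₂ , Y↭ , q₁ , q₂ ← path-split y∈Y q =
        classify no-short-triangle
          (tetra r p₁ q₁ (path-sym p₂) (path-sym q₂) c (Unique-resp-↭
            (↭-trans (++⁺ X↭ (++⁺ʳ _ Y↭))
              (solve 10 (λ s t x y X₁ X₂ Y₁ Y₂ Z l →
                (x ⊕ X₁ ⊕ X₂) ⊕ (y ⊕ Y₁ ⊕ Y₂) ⊕ s ⊕ t ⊕ Z ⊕ l ⊜
                s ⊕ t ⊕ x ⊕ y ⊕ Z ⊕ X₁ ⊕ Y₁ ⊕ X₂ ⊕ Y₂ ⊕ l) ↭-refl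
                [ s ] [ t ] [ x ] [ y ] X₁ X₂ Y₁ Y₂ Z l)) uniq))

      -- Deleting `s` and `t` leaves a link from the interior of `X` to another arm. The arm `Z` may
      -- be a single edge.
      theta-tetra : Path J s X t → Path J s Y t → Path J s Z t → x ∈ˡ X → y ∈ˡ Y →
                    Unique (s ∷ t ∷ X ++ Y ++ Z) → LongTetra ⊎ SomeSquare
      theta-tetra {s} {X} {t} {Y} {Z} p q r x∈X y∈Y uniq
        with _ , _ , l , x′∈X , y′∈YZ , c , uniq′ ← crossing J J3
          (path-source p) (path-source (path-sym p)) X (Y ++ Z) x∈X (∈-++⁺ˡ y∈Y)
          (path-inner⊆V x∈X p) (path-inner⊆V y∈Y q) uniq
        with ∈-++⁻ Y y′∈YZ
      ... | inj₁ y′∈Y = theta-with-crossing p q r x′∈X y′∈Y c (Unique-resp-↭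
        (solve 6 (λ s t X Y Z l → (s ⊕ t ⊕ X ⊕ (Y ⊕ Z)) ⊕ l ⊜ X ⊕ Y ⊕ s ⊕ t ⊕ Z ⊕ l) ↭-refl
          [ s ] [ t ] X Y Z l) uniq′)
      ... | inj₂ y′∈Z = theta-with-crossing p r q x′∈X y′∈Z c (Unique-resp-↭
        (solve 6 (λ s t X Y Z l → (s ⊕ t ⊕ X ⊕ (Y ⊕ Z)) ⊕ l ⊜ X ⊕ Z ⊕ s ⊕ t ⊕ Y ⊕ l) ↭-refl
          [ s ] [ t ] X Y Z l) uniq′)

      -- The neighbour is the first vertex after `v` on a path to `w` that avoids `s` and `t`.
      neighbour-avoiding : ∀ {v w} → s ∈ V J → t ∈ V J → v ∈ V J → w ∈ V J →
                           Unique (s ∷ t ∷ v ∷ w ∷ []) → ∃[ x ] Adj J v x × x ≢ s × x ≢ t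
      neighbour-avoiding {s} {t} {v} {w} s∈ t∈ v∈ w∈ uniq
        with _ , _ , l , here refl , here refl , p , s∉ ∷ t∉ ∷ _ ←
          crossing J J3 s∈ t∈ [ v ] [ w ] (here refl) (here refl) v∈ w∈ uniq
        with x , e , x∈l ← path-first p =
        let x∈ = [ here ∘ proj₂ , there ]′ x∈l in
        x , e , ≢-sym (All.lookup s∉ (there (there x∈))) , ≢-sym (All.lookup t∉ (there x∈))

      unique₄ : ∀ {u v w x : Fin m} → u ≢ v → u ≢ w → u ≢ x → v ≢ w → v ≢ x → w ≢ x →
                Unique (u ∷ v ∷ w ∷ x ∷ [])
      unique₄ uv uw ux vw vx wx =
        (uv ∷ uw ∷ ux ∷ []) ∷ (vw ∷ vx ∷ []) ∷ (wx ∷ []) ∷ [] ∷ []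

      adj⇒≢ : ∀ {u v} → Adj J u v → u ≢ v
      adj⇒≢ e refl = N-irrefl J e

      -- Each use of `neighbour-avoiding` excludes two vertices and needs a further one as target.
      -- Therefore `p` is kept off `u₂` and `u₃`, and `q` off `u₂`: `u₃` is the target when `q` is
      -- chosen, and `u₂` when `r` is chosen.
      three-neighbours : ∃[ v ] ∃[ p ] ∃[ q ] ∃[ r ]
        Adj J v p × Adj J v q × Adj J v r × p ≢ q × p ≢ r × q ≢ r
      three-neighbours
        with u₁ , u₁∈ , _   ← outside-list (V J) [] (ℕ.≤-trans (s≤s z≤n) (proj₁ J3))
        with u₂ , u₂∈ , u₂∉ ← outside-list (V J) (u₁ ∷ []) (ℕ.≤-trans (s≤s (s≤s z≤n)) (proj₁ J3))
        with u₃ , u₃∈ , u₃∉ ← outside-list (V J) (u₁ ∷ u₂ ∷ []) (ℕ.≤-trans (s≤s (s≤s (s≤s z≤n))) (proj₁ J3))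
        with u₄ , u₄∈ , u₄∉ ← outside-list (V J) (u₁ ∷ u₂ ∷ u₃ ∷ []) (proj₁ J3)
        with u₂≢u₁ ∷ [] ← All.¬Any⇒All¬ (u₁ ∷ []) u₂∉
           | u₃≢u₁ ∷ u₃≢u₂ ∷ [] ← All.¬Any⇒All¬ (u₁ ∷ u₂ ∷ []) u₃∉
           | u₄≢u₁ ∷ u₄≢u₂ ∷ u₄≢u₃ ∷ [] ← All.¬Any⇒All¬ (u₁ ∷ u₂ ∷ u₃ ∷ []) u₄∉
        with p , vp , p≢u₂ , p≢u₃ ← neighbour-avoiding u₂∈ u₃∈ u₁∈ u₄∈
          (unique₄ (≢-sym u₃≢u₂) u₂≢u₁ (≢-sym u₄≢u₂) u₃≢u₁ (≢-sym u₄≢u₃) (≢-sym u₄≢u₁))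
        with q , vq , q≢p , q≢u₂ ← neighbour-avoiding (N⊆V J vp) u₂∈ u₁∈ u₃∈
          (unique₄ p≢u₂ (≢-sym (adj⇒≢ vp)) p≢u₃ u₂≢u₁ (≢-sym u₃≢u₂) (≢-sym u₃≢u₁))
        with r , vr , r≢p , r≢q ← neighbour-avoiding (N⊆V J vp) (N⊆V J vq) u₁∈ u₂∈
          (unique₄ (≢-sym q≢p) (≢-sym (adj⇒≢ vp)) p≢u₂ (≢-sym (adj⇒≢ vq)) q≢u₂ (≢-sym u₂≢u₁)) =
        u₁ , p , q , r , vp , vq , vr , ≢-sym q≢p , ≢-sym r≢p , ≢-sym r≢q

      -- A path from `p` to `q` avoiding `v` and `r` closes a cycle through `v`. A path from `r`
      -- that avoids `v` and `q` hits this cycle at some `y`. The result is a theta graph with ends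
      -- `v` and `y`, in which `q` and `r` are internal to two different arms.
      claw-tetra : ∀ {v p q r} → Adj J v p → Adj J v q → Adj J v r →
                   p ≢ q → p ≢ r → q ≢ r → LongTetra ⊎ SomeSquare
      claw-tetra {v} {p} {q} {r} vp vq vr p≢q p≢r q≢r
        with _ , _ , l , here refl , here refl , pq , uniq ←
          crossing J J3 (N⊆V J (N-sym J vp)) (N⊆V J vr) [ p ] [ q ] (here refl) (here refl)
            (N⊆V J vp) (N⊆V J vq)
            (unique₄ (adj⇒≢ vr) (adj⇒≢ vp) (adj⇒≢ vq) (≢-sym p≢r) (≢-sym q≢r) p≢q)
        with _ , y , l′ , here refl , y∈ , ry , uniq′ ←
          crossing J J3 (N⊆V J (N-sym J vp)) (N⊆V J vq) [ r ] (p ∷ l) (here refl) (here refl)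
            (N⊆V J vr) (N⊆V J vp)
            (Unique-resp-↭
              (solve 5 (λ v r p q l → (v ⊕ r ⊕ p ⊕ q ⊕ id) ⊕ l ⊜ v ⊕ q ⊕ r ⊕ p ⊕ l) ↭-refl
                [ v ] [ r ] [ p ] [ q ] l) uniq)
        with as , bs , pl↭ , vy , yq ← path-split y∈ (path-++ (path-edge vp) pq) =
        theta-tetra (path-++ (path-edge vq) (path-sym yq)) (path-++ (path-edge vr) ry) vy
          (here refl) (here refl) (Unique-resp-↭
            (↭-trans (solve 5 (λ v q r pl l′ → (v ⊕ q ⊕ r ⊕ pl) ⊕ l′ ⊜ pl ⊕ v ⊕ q ⊕ r ⊕ l′) ↭-refl
                       [ v ] [ q ] [ r ] (p ∷ l) l′)
            (↭-trans (++⁺ʳ _ pl↭)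
              (solve 7 (λ v q r y as bs l′ →
                (y ⊕ as ⊕ bs) ⊕ v ⊕ q ⊕ r ⊕ l′ ⊜ v ⊕ y ⊕ (q ⊕ bs) ⊕ (r ⊕ l′) ⊕ as) ↭-refl
                [ v ] [ q ] [ r ] [ y ] as bs l′))) uniq′)

    some-tetra : LongTetra ⊎ SomeSquare
    some-tetra = let v , p , q , r , vp , vq , vr , p≢q , p≢r , q≢r = three-neighbours
                 in claw-tetra vp vq vr p≢q p≢r q≢r

    -- Extending a square or a K₃,₃ by further vertices and edges.

    private
      SomeK₃₃ : Set
      SomeK₃₃ = ∃₂ λ a₁ a₂ → ∃₂ λ a₃ b₁ → ∃₂ λ b₂ b₃ → K₃₃ a₁ a₂ a₃ b₁ b₂ b₃

    -- With `a` and `c` deleted, the interior of `P` is linked to `b`, `d` or the interior of `Q`.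
    -- The case of `d` is the reflection of that of `b`; landing in `Q` gives a hexagon.
    square-inner : Square a b c d P Q → x ∈ˡ P → LongTetra ⊎ SomeK₃₃
    square-inner {a} {b} {c} {d} {P} {Q} S@(square ab bc cd da p q lp lq uniq) x∈P
      with x , y , R , x′∈P , y∈ , r , uniq′ ←
        crossing J J3 (path-source p) (path-source (path-sym p)) P (b ∷ d ∷ Q) x∈P (here refl)
          (path-inner⊆V x∈P p) (path-source q)
          (Unique-resp-↭
            (solve 6 (λ a b c d P Q → P ⊕ Q ⊕ a ⊕ b ⊕ c ⊕ d ⊕ id ⊜ a ⊕ c ⊕ P ⊕ b ⊕ d ⊕ Q) ↭-refl
              [ a ] [ b ] [ c ] [ d ] P Q) uniq)
      with P₁ , P₂ , P↭ , p₁ , p₂ ← path-split x′∈P p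
      with uniq″ ← Unique-resp-↭
        (solve 7 (λ a b c d P Q R →
          (a ⊕ c ⊕ P ⊕ b ⊕ d ⊕ Q) ⊕ R ⊜ P ⊕ Q ⊕ a ⊕ b ⊕ c ⊕ d ⊕ R) ↭-refl
          [ a ] [ b ] [ c ] [ d ] P Q R) uniq′
      with y∈
    ... | here refl = inj₁ (square-with-triangle S p₁ p₂ r (Unique-resp-↭ (++⁺ʳ _ P↭) uniq″))
    ... | there (here refl) = inj₁ (square-with-triangle (square-flip S) p₁ p₂ r (Unique-resp-↭
      (↭-trans (++⁺ʳ _ P↭)
        (solve 7 (λ a b c d P Q R →
          P ⊕ Q ⊕ a ⊕ b ⊕ c ⊕ d ⊕ R ⊜ P ⊕ Q ⊕ a ⊕ d ⊕ c ⊕ b ⊕ R) ↭-refl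
          [ a ] [ b ] [ c ] [ d ] (x ∷ P₁ ++ P₂) Q R)) uniq″))
    ... | there (there y∈Q)
      with Q₁ , Q₂ , Q↭ , q₁ , q₂ ← path-split y∈Q q =
      Sum.map₂ (λ K → _ , _ , _ , _ , _ , _ , K)
        (hexagon-K₃₃ (hexagon ab bc cd da p₁ p₂ q₁ q₂ r (Unique-resp-↭ (++⁺ P↭ (++⁺ʳ _ Q↭)) uniq″)))

    private
      -- With `b` and `d` deleted, the branch ending at `b` is linked to `a` or `c`. Link and branch
      -- together form a path parallel to the edge from `b` to that vertex, with at least the
      -- internal vertex `x`.
      K₄-with-branch : ∀ {z l} → Square a b c d [] [] → Path J z l b →
                       Unique ((z ∷ l) ++ a ∷ b ∷ c ∷ d ∷ []) → LongTetra
      K₄-with-branch {a} {b} {c} {d} {z} {l} S zb uniq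
        with x , y , l′ , x∈ , y∈ , xy , uniq′ ←
          crossing J J3 (path-source (path-sym zb)) (N⊆V J (proj₁ (Square.edge-cd S)))
            (z ∷ l) (a ∷ c ∷ []) (here refl) (here refl) (path-source zb)
            (path-source (Square.path-P S))
            (Unique-resp-↭
              (solve 5 (λ a b c d zl → zl ⊕ a ⊕ b ⊕ c ⊕ d ⊕ id ⊜ b ⊕ d ⊕ zl ⊕ a ⊕ c ⊕ id) ↭-refl
                [ a ] [ b ] [ c ] [ d ] (z ∷ l)) uniq)
        -- Only the part of the branch from `x` to `b` is used; `as` is dropped from the uniqueness
        -- list.
        with as , bs , zl↭ , xb ← path-suffix x∈ zb
        with uniq″ ← Unique-drop {ys = a ∷ b ∷ c ∷ d ∷ l′ ++ x ∷ bs} {zs = as}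
          (↭-trans
            (solve 6 (λ a b c d zl l′ →
              (b ⊕ d ⊕ zl ⊕ a ⊕ c ⊕ id) ⊕ l′ ⊜ zl ⊕ a ⊕ b ⊕ c ⊕ d ⊕ l′) ↭-refl
              [ a ] [ b ] [ c ] [ d ] (z ∷ l) l′)
          (↭-trans (++⁺ʳ _ zl↭)
            (solve 8 (λ a b c d x as bs l′ →
              (x ⊕ as ⊕ bs) ⊕ a ⊕ b ⊕ c ⊕ d ⊕ l′ ⊜ (a ⊕ b ⊕ c ⊕ d ⊕ l′ ⊕ x ⊕ bs) ⊕ as) ↭-refl
              [ a ] [ b ] [ c ] [ d ] [ x ] as bs l′))) uniq′
        with y∈
      ... | here refl = square-with-parallel S (path-++ (path-sym xy) xb) (++∷≢[] l′) uniq″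
      ... | there (here refl) =
        square-with-parallel (square-flip (square-rotate (square-rotate S)))
          (path-++ (path-sym xy) xb) (++∷≢[] l′) (Unique-resp-↭
            (solve 5 (λ a b c d R → a ⊕ b ⊕ c ⊕ d ⊕ R ⊜ c ⊕ b ⊕ a ⊕ d ⊕ R) ↭-refl
              [ a ] [ b ] [ c ] [ d ] (l′ ++ x ∷ bs)) uniq″)

      -- Deleting `a` and `c` links the new vertex to `b` or `d`, and `square-flip` exchanges these
      -- two.
      K₄-with-vertex : ∀ {z} → Square a b c d [] [] → z ∈ V J →
                       z ∉ˡ a ∷ b ∷ c ∷ d ∷ [] → LongTetra
      K₄-with-vertex {a} {b} {c} {d} {z} S z∈ z∉
        with _ , _ , l , here refl , y∈ , zy , uniq ←
          crossing J J3 (path-source (Square.path-P S)) (N⊆V J (proj₁ (Square.edge-bc S)))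
            [ z ] (b ∷ d ∷ []) (here refl) (here refl) z∈ (path-source (Square.path-Q S))
            (Unique-resp-↭
              (solve 5 (λ a b c d z → z ⊕ a ⊕ b ⊕ c ⊕ d ⊕ id ⊜ a ⊕ c ⊕ z ⊕ b ⊕ d ⊕ id) ↭-refl
                [ a ] [ b ] [ c ] [ d ] [ z ]) (All.¬Any⇒All¬ _ z∉ ∷ Square.unique S))
        with y∈
      ... | here refl = K₄-with-branch S zy (Unique-resp-↭
        (solve 6 (λ a b c d z l → (a ⊕ c ⊕ z ⊕ b ⊕ d ⊕ id) ⊕ l ⊜ (z ⊕ l) ⊕ a ⊕ b ⊕ c ⊕ d ⊕ id) ↭-refl
          [ a ] [ b ] [ c ] [ d ] [ z ] l) uniq)
      ... | there (here refl) = K₄-with-branch (square-flip S) zy (Unique-resp-↭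
        (solve 6 (λ a b c d z l → (a ⊕ c ⊕ z ⊕ b ⊕ d ⊕ id) ⊕ l ⊜ (z ⊕ l) ⊕ a ⊕ d ⊕ c ⊕ b ⊕ id) ↭-refl
          [ a ] [ b ] [ c ] [ d ] [ z ] l) uniq)

      -- With `a₁` and `a₂` deleted, the branch is linked to one of the other four vertices. Link
      -- and branch give a path with an internal vertex from `a₁` to that vertex.
      K₃₃-with-branch : ∀ {z l} → K₃₃ a₁ a₂ a₃ b₁ b₂ b₃ → Path J z l a₁ →
                        Unique ((z ∷ l) ++ a₁ ∷ a₂ ∷ a₃ ∷ b₁ ∷ b₂ ∷ b₃ ∷ []) → LongTetra
      K₃₃-with-branch {a₁} {a₂} {a₃} {b₁} {b₂} {b₃} {z} {l} K za uniq
        with x , y , l′ , x∈ , y∈ , xy , uniq′ ←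
          crossing J J3 (path-source (path-sym za)) (path-source (short-path (K₃₃.e₂₁ K)))
            (z ∷ l) (a₃ ∷ b₁ ∷ b₂ ∷ b₃ ∷ []) (here refl) (here refl) (path-source za)
            (path-source (short-path (K₃₃.e₃₁ K)))
            (Unique-resp-↭
              (solve 4 (λ a₁ a₂ zl w → zl ⊕ a₁ ⊕ a₂ ⊕ w ⊜ a₁ ⊕ a₂ ⊕ zl ⊕ w) ↭-refl
                [ a₁ ] [ a₂ ] (z ∷ l) (a₃ ∷ b₁ ∷ b₂ ∷ b₃ ∷ [])) uniq)
        with as , bs , zl↭ , xa ← path-suffix x∈ za =
        K₃₃-attach K (there y∈) (path-++ (path-sym xa) xy) (++∷≢[] bs)
          (Unique-drop {zs = as}
            (↭-trans
              (solve 5 (λ a₁ a₂ zl w l′ → (a₁ ⊕ a₂ ⊕ zl ⊕ w) ⊕ l′ ⊜ zl ⊕ a₁ ⊕ a₂ ⊕ w ⊕ l′) ↭-refl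
                [ a₁ ] [ a₂ ] (z ∷ l) (a₃ ∷ b₁ ∷ b₂ ∷ b₃ ∷ []) l′)
            (↭-trans (++⁺ʳ _ zl↭)
              (solve 7 (λ a₁ a₂ x as bs w l′ →
                (x ⊕ as ⊕ bs) ⊕ a₁ ⊕ a₂ ⊕ w ⊕ l′ ⊜ ((bs ⊕ x ⊕ l′) ⊕ a₁ ⊕ a₂ ⊕ w) ⊕ as) ↭-refl
                [ a₁ ] [ a₂ ] [ x ] as bs (a₃ ∷ b₁ ∷ b₂ ∷ b₃ ∷ []) l′))) uniq′)

      -- A path from the new vertex reaches the K₃,₃ after `a₁` and `a₂` are deleted; the symmetries
      -- of K₃,₃ rename its end to `a₁`.
      K₃₃-with-vertex : ∀ {z} → K₃₃ a₁ a₂ a₃ b₁ b₂ b₃ → z ∈ V J →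
                        z ∉ˡ a₁ ∷ a₂ ∷ a₃ ∷ b₁ ∷ b₂ ∷ b₃ ∷ [] → LongTetra
      K₃₃-with-vertex {a₁} {a₂} {a₃} {b₁} {b₂} {b₃} {z} K z∈ z∉
        with _ , _ , l , here refl , y∈ , zy , uniq ←
          crossing J J3 (path-source (short-path (K₃₃.e₁₁ K))) (path-source (short-path (K₃₃.e₂₁ K)))
            [ z ] (a₃ ∷ b₁ ∷ b₂ ∷ b₃ ∷ []) (here refl) (here refl) z∈
            (path-source (short-path (K₃₃.e₃₁ K)))
            (Unique-resp-↭
              (solve 4 (λ a₁ a₂ z w → z ⊕ a₁ ⊕ a₂ ⊕ w ⊜ a₁ ⊕ a₂ ⊕ z ⊕ w) ↭-refl
                [ a₁ ] [ a₂ ] [ z ] (a₃ ∷ b₁ ∷ b₂ ∷ b₃ ∷ [])) (All.¬Any⇒All¬ _ z∉ ∷ K₃₃.unique K))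
        with _ , _ , _ , _ , _ , K′ , K↭ ← K₃₃-reorder K (there (there y∈)) =
        K₃₃-with-branch K′ zy (Unique-resp-↭
          (↭-trans
            (solve 5 (λ a₁ a₂ z w l → (a₁ ⊕ a₂ ⊕ z ⊕ w) ⊕ l ⊜ (z ⊕ l) ⊕ a₁ ⊕ a₂ ⊕ w) ↭-refl
              [ a₁ ] [ a₂ ] [ z ] (a₃ ∷ b₁ ∷ b₂ ∷ b₃ ∷ []) l)
            (++⁺ˡ (z ∷ l) K↭)) uniq)

      K₃₃-chord : K₃₃ a₁ a₂ a₃ b₁ b₂ b₃ → Adj J a₁ a₂ → Outcome
      K₃₃-chord K e = long-tetra (K₃₃-same-side K (path-edge e) (K₃₃.unique K))

    -- All edges between the sides are present, so without further vertices an extra edge of `J`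
    -- joins two vertices of one side.
    K₃₃-outcome : K₃₃ a₁ a₂ a₃ b₁ b₂ b₃ → Outcome
    K₃₃-outcome {a₁} {a₂} {a₃} {b₁} {b₂} {b₃} K
      with outside-list? (V J) (a₁ ∷ a₂ ∷ a₃ ∷ b₁ ∷ b₂ ∷ b₃ ∷ [])
    ... | inj₁ (z , z∈ , z∉) = long-tetra (K₃₃-with-vertex K z∈ z∉)
    ... | inj₂ cover
      with a₂ ∈? N J a₁ | a₃ ∈? N J a₁ | a₃ ∈? N J a₂ | b₂ ∈? N J b₁ | b₃ ∈? N J b₁ | b₃ ∈? N J b₂
    ... | yes e | _ | _ | _ | _ | _ = K₃₃-chord K e
    ... | _ | yes e | _ | _ | _ | _ = K₃₃-chord (K₃₃-swap₂₃ K) e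
    ... | _ | _ | yes e | _ | _ | _ = K₃₃-chord (K₃₃-swap₂₃ (K₃₃-swap₁₂ K)) e
    ... | _ | _ | _ | yes e | _ | _ = K₃₃-chord (K₃₃-transpose K) e
    ... | _ | _ | _ | _ | yes e | _ = K₃₃-chord (K₃₃-swap₂₃ (K₃₃-transpose K)) e
    ... | _ | _ | _ | _ | _ | yes e = K₃₃-chord (K₃₃-swap₂₃ (K₃₃-swap₁₂ (K₃₃-transpose K))) e
    ... | no e₁ | no e₂ | no e₃ | no e₄ | no e₅ | no e₆ = only-K₃₃ K cover e₁ e₂ e₃ e₄ e₅ e₆

    private
      square-inner-outcome : Square a b c d P Q → x ∈ˡ P → Outcome
      square-inner-outcome S x∈P =
        [ long-tetra , (λ (_ , _ , _ , _ , _ , _ , K) → K₃₃-outcome K) ]′ (square-inner S x∈P)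

    square-outcome : Square a b c d P Q → Outcome
    square-outcome {P = _ ∷ _} S = square-inner-outcome S (here refl)
    square-outcome {P = []} {Q = _ ∷ _} S = square-inner-outcome (square-rotate S) (here refl)
    square-outcome {a} {b} {c} {d} {P = []} {Q = []} S@(square ab bc cd da p q _ _ uniq)
      with outside-list? (V J) (a ∷ b ∷ c ∷ d ∷ [])
    ... | inj₁ (z , z∈ , z∉) = long-tetra (K₄-with-vertex S z∈ z∉)
    ... | inj₂ cover = only-K₄
      (tetra (short-path ab) p (short-path (shortEdge-sym da)) (short-path bc) q (short-path cd) uniq)
      cover

    outcome : Outcome
    outcome = [ long-tetra , (λ (_ , _ , _ , _ , _ , _ , S) → square-outcome S) ]′ some-tetra

-- Subsets with three elements and decidable subsets.

three≤∣p∣ : ∀ {p : Subset n} → x ∈ p → y ∈ p → z ∈ p → x ≢ y → x ≢ z → y ≢ z → 3 ≤ⁿ ∣ p ∣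
three≤∣p∣ x∈ y∈ z∈ x≢y x≢z y≢z =
  let y∈′ = x∈p∧x≢y⇒x∈p-y y∈ (≢-sym x≢y)
      z∈′ = x∈p∧x≢y⇒x∈p-y (x∈p∧x≢y⇒x∈p-y z∈ (≢-sym x≢z)) (≢-sym y≢z)
  in ℕ.≤-trans (s≤s (ℕ.≤-trans (s≤s (ℕ.≤-trans (s≤s z≤n) (x∈p⇒∣p-x∣<∣p∣ z∈′)))
       (x∈p⇒∣p-x∣<∣p∣ y∈′))) (x∈p⇒∣p-x∣<∣p∣ x∈)

module _ {P : Fin n → Set} (P? : Decidable P) where

  decSubset : Subset n
  decSubset = tabulate (does ∘ P?)

  ∈-decSubset⁺ : P x → x ∈ decSubset
  ∈-decSubset⁺ {x} px =
    lookup⇒[]= x _ (trans (lookup∘tabulate (does ∘ P?) x) (dec-true (P? x) px))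

  ∈-decSubset⁻ : x ∈ decSubset → P x
  ∈-decSubset⁻ {x} x∈ with P? x | trans (sym (lookup∘tabulate (does ∘ P?) x)) ([]=⇒lookup x∈)
  ... | yes px | _ = px

-- Successors in a list and neighbours on a cycle.

-- An inductive form of `Consecutive`, suited to recursion and to a decision procedure.
data Next {n} (x y : Fin n) : List (Fin n) → Set where
  here  : Next x y (x ∷ y ∷ zs)
  there : Next x y zs → Next x y (z ∷ zs)

next⇒consecutive : Next x y zs → Consecutive x y zs
next⇒consecutive here                = [] , _ , refl
next⇒consecutive (there {z = z} n) with as , bs , refl ← next⇒consecutive n = z ∷ as , bs , refl

next-++ : ∀ as {bs} → Next x y (as ++ x ∷ y ∷ bs)
next-++ []       = here
next-++ (_ ∷ as) = there (next-++ as)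

consecutive⇒next : Consecutive x y zs → Next x y zs
consecutive⇒next (as , _ , refl) = next-++ as

next⇒∈ˡ : Next x y zs → x ∈ˡ zs
next⇒∈ˡ here      = here refl
next⇒∈ˡ (there n) = there (next⇒∈ˡ n)

next⇒∈ʳ : Next x y zs → y ∈ˡ zs
next⇒∈ʳ here      = there (here refl)
next⇒∈ʳ (there n) = there (next⇒∈ʳ n)

next? : ∀ (x y : Fin n) zs → Dec (Next x y zs)
next? x y []           = no λ ()
next? x y (z ∷ [])     = no λ { (there ()) }
next? x y (z ∷ w ∷ zs) =
  map′ [ (λ { (refl , refl) → here }) , there ]′
       (λ { here → inj₁ (refl , refl) ; (there n) → inj₂ n })
       ((x ≟ z ×-dec y ≟ w) ⊎-dec next? x y (w ∷ zs))

linked⇒next : ∀ {R : Fin n → Fin n → Set} → Linked R zs → Next x y zs → R x y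
linked⇒next (r ∷ _)  here      = r
linked⇒next (_ ∷ rs) (there n) = linked⇒next rs n
linked⇒next [-]      (there ())

next⇒linked : ∀ {R : Fin n → Fin n → Set} zs → (∀ {x y} → Next x y zs → R x y) → Linked R zs
next⇒linked []           f = []
next⇒linked (_ ∷ [])     f = [-]
next⇒linked (_ ∷ _ ∷ zs) f = f here ∷ next⇒linked (_ ∷ zs) (f ∘ there)

next-irrefl : Unique zs → ¬ Next x x zs
next-irrefl ((x≢x ∷ _) ∷ _) here      = x≢x refl
next-irrefl (_ ∷ uniq)      (there n) = next-irrefl uniq n

next-unique : Unique zs → Next x y zs → Next x s zs → y ≡ s
next-unique _          here      here      = refl
next-unique uniq       here      (there q) = contradiction (next⇒∈ˡ q) (Unique-∷⇒∉ uniq)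
next-unique uniq       (there p) here      = contradiction (next⇒∈ˡ p) (Unique-∷⇒∉ uniq)
next-unique (_ ∷ uniq) (there p) (there q) = next-unique uniq p q

next-head⇒∈ : Next y x (x ∷ zs) → x ∈ˡ zs
next-head⇒∈ here      = here refl
next-head⇒∈ (there n) = next⇒∈ʳ n

previous-unique : Unique zs → Next y x zs → Next s x zs → y ≡ s
previous-unique _          here      here      = refl
previous-unique (_ ∷ uniq) here      (there q) = contradiction (next-head⇒∈ q) (Unique-∷⇒∉ uniq)
previous-unique (_ ∷ uniq) (there p) here      = contradiction (next-head⇒∈ p) (Unique-∷⇒∉ uniq)
previous-unique (_ ∷ uniq) (there p) (there q) = previous-unique uniq p q

next-∷ʳ : Next x y zs → Next x y (zs ∷ʳ z)
next-∷ʳ here      = here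
next-∷ʳ (there n) = there (next-∷ʳ n)

next-reverse : Next x y zs → Next y x (reverse zs)
next-reverse {x = x} {y} (here {zs = zs})
  rewrite unfold-reverse x (y ∷ zs) | unfold-reverse y zs = last-two (reverse zs)
  where
  last-two : ∀ zs → Next y x ((zs ∷ʳ y) ∷ʳ x)
  last-two []       = here
  last-two (_ ∷ zs) = there (last-two zs)
next-reverse (there {zs = zs} {z = z} n) rewrite unfold-reverse z zs = next-∷ʳ (next-reverse n)

next-inner : x ∈ˡ xs → ∃₂ λ p s → Next p x (u ∷ xs ∷ʳ v) × Next x s (u ∷ xs ∷ʳ v)
next-inner {u = u} {v = v} x∈ = go u x∈
  where
  after : ∀ {x xs} → ∃[ s ] Next x s (x ∷ xs ∷ʳ v)
  after {xs = []}    = _ , here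
  after {xs = _ ∷ _} = _ , here
  go : ∀ u {x xs} → x ∈ˡ xs → ∃₂ λ p s → Next p x (u ∷ xs ∷ʳ v) × Next x s (u ∷ xs ∷ʳ v)
  go u {xs = _ ∷ xs} (here refl) = _ , _ , here , there (proj₂ (after {xs = xs}))
  go u (there x∈) with _ , _ , q , r ← go _ x∈ = _ , _ , there q , there r

∈-path⁻ : ∀ xs → x ∈ˡ u ∷ xs ∷ʳ v → x ≡ u ⊎ x ∈ˡ xs ⊎ x ≡ v
∈-path⁻ xs (here eq) = inj₁ eq
∈-path⁻ xs (there x∈) with ∈-++⁻ xs x∈
... | inj₁ x∈xs      = inj₂ (inj₁ x∈xs)
... | inj₂ (here eq) = inj₂ (inj₂ eq)

next-avoiding-inner : Next x y (u ∷ z ∷ xs ∷ʳ v) → x ∈ˡ z ∷ xs ⊎ y ∈ˡ z ∷ xs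
next-avoiding-inner here      = inj₂ (here refl)
next-avoiding-inner (there n) = inj₁ (not-last _ n)
  where
  not-last : ∀ xs → Next x y (xs ∷ʳ v) → x ∈ˡ xs
  not-last (_ ∷ [])     here      = here refl
  not-last (_ ∷ _ ∷ _)  here      = here refl
  not-last (_ ∷ xs)     (there n) = there (not-last xs n)
  not-last []           (there ())

linked⇒walk : ∀ {G : Graph n} xs → Linked (Adj G) (u ∷ xs ∷ʳ v) → Walk G u xs v
linked⇒walk []       (e ∷ _) = edge e
linked⇒walk (_ ∷ xs) (e ∷ l) = e ∷ linked⇒walk xs l

walk⇒linked : ∀ {G : Graph n} → Walk G u xs v → Linked (Adj G) (u ∷ xs ∷ʳ v)
walk⇒linked (edge e) = e ∷ [-]
walk⇒linked (e ∷ p)  = e ∷ walk⇒linked p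

cycle-neighbours : ∀ {G : Graph n} → IsCycle G xs → v ∈ˡ xs →
                   ∃₂ λ y z → y ≢ z × y ∈ˡ xs × z ∈ˡ xs × Adj G v y × Adj G v z
cycle-neighbours {G = G} (cycle {x} {xs} 3≤ uniq linked) v∈ = at {G = G} v∈ 3≤ uniq (linked⇒walk xs linked)
  where
  at : ∀ {G v x xs} → v ∈ˡ x ∷ xs → 3 ≤ⁿ length (x ∷ xs) → Unique (x ∷ xs) → Walk G x xs x →
       ∃₂ λ y z → y ≢ z × y ∈ˡ x ∷ xs × z ∈ˡ x ∷ xs × Adj G v y × Adj G v z
  at (here refl) (s≤s (s≤s ())) _ (e ∷ edge _)
  at (here refl) _ (_ ∷ uniq) (_∷_ {x = y} e q@(_ ∷ _))
    with path-first (path-sym (walk⇒path q))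
  ... | z , e′ , inj₂ z∈ =
    y , z , (λ { refl → Unique-∷⇒∉ uniq z∈ }) , there (here refl) , there (there z∈) , e , e′
  at (there v∈) 3≤ (x∉ ∷ uniq) q
    with as , bs , refl ← ∈-∃++ v∈
    with q₁ , q₂ ← walk-split as q
    with y , e , y∈ ← path-first (path-sym (walk⇒path q₁))
       | z , e′ , z∈ ← path-first (walk⇒path q₂)
    with y∈ | z∈
  -- If both neighbours are the base vertex, the cycle has only two vertices.
  ... | inj₁ (refl , refl) | inj₁ (refl , refl) = contradiction 3≤ λ { (s≤s (s≤s ())) }
  ... | inj₁ (refl , refl) | inj₂ z∈bs =
    y , z , All.lookup x∉ (there z∈bs) , here refl , there (there z∈bs) , e , e′
  ... | inj₂ y∈as | inj₁ (refl , refl) =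
    y , z , ≢-sym (All.lookup x∉ (∈-++⁺ˡ y∈as)) , there (∈-++⁺ˡ y∈as) , here refl , e , e′
  ... | inj₂ y∈as | inj₂ z∈bs =
    y , z , (λ { refl → Unique-++⇒∉ as uniq y∈as (there z∈bs) }) ,
    there (∈-++⁺ˡ y∈as) , there (∈-++⁺ʳ as (there z∈bs)) , e , e′

-- The subgraph spanned by an embedded subdivision.

-- IsSubdivision without the covering conditions.
record Embedding (J : Graph m) (H : Graph n) : Set where
  field
    ρ     : Fin m → Fin n
    inner : Fin m → Fin m → List (Fin n)

  path : Fin m → Fin m → List (Fin n)
  path u v = ρ u ∷ inner u v ∷ʳ ρ v

  field
    ρ-V            : ∀ {u} → u ∈ V J → ρ u ∈ V H
    ρ-injective    : ∀ {u v} → u ∈ V J → v ∈ V J → ρ u ≡ ρ v → u ≡ v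
    path-isPath    : ∀ {u v} → Edge J u v → IsPath H (path u v)
    inner-avoids-ρ : ∀ {u v w} → Edge J u v → w ∈ V J → ¬ (ρ w ∈ˡ inner u v)
    inner-disjoint : ∀ {u v u′ v′ x} → Edge J u v → Edge J u′ v′ →
                     x ∈ˡ inner u v → x ∈ˡ inner u′ v′ → u ≡ u′ × v ≡ v′

module _ {J : Graph m} {H : Graph n} (E : Embedding J H) where

  open Embedding E

  private
    _∈ˡ?_ = DecMembership._∈?_ (_≟_ {n})

    OnVertex : Fin n → Set
    OnVertex x = (∃[ u ] u ∈ V J × x ≡ ρ u) ⊎ (∃[ u ] ∃[ v ] Edge J u v × x ∈ˡ inner u v)

    OnEdge : Fin n → Fin n → Set
    OnEdge x y = ∃[ u ] ∃[ v ] Edge J u v × (Next x y (path u v) ⊎ Next y x (path u v))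

    edge? : ∀ u v → Dec (Edge J u v)
    edge? u v = u <? v ×-dec v ∈? N J u

    onVertex? : Decidable OnVertex
    onVertex? x = any? (λ u → u ∈? V J ×-dec x ≟ ρ u) ⊎-dec
                  any? (λ u → any? λ v → edge? u v ×-dec x ∈ˡ? inner u v)

    onEdge? : ∀ x → Decidable (OnEdge x)
    onEdge? x y = any? λ u → any? λ v →
      edge? u v ×-dec (next? x y (path u v) ⊎-dec next? y x (path u v))

    ∈-path⇒onVertex : Edge J u v → x ∈ˡ path u v → OnVertex x
    ∈-path⇒onVertex {u} {v} e x∈ with ∈-path⁻ (inner u v) x∈
    ... | inj₁ eq        = inj₁ (u , N⊆V J (N-sym J (proj₂ e)) , eq)
    ... | inj₂ (inj₁ x∈) = inj₂ (u , v , e , x∈)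
    ... | inj₂ (inj₂ eq) = inj₁ (v , N⊆V J (proj₂ e) , eq)

    onEdge⇒onVertex : OnEdge x y → OnVertex y
    onEdge⇒onVertex (u , v , e , inj₁ n) = ∈-path⇒onVertex e (next⇒∈ʳ n)
    onEdge⇒onVertex (u , v , e , inj₂ n) = ∈-path⇒onVertex e (next⇒∈ˡ n)

    onEdge-sym : OnEdge x y → OnEdge y x
    onEdge-sym (u , v , e , n) = u , v , e , swap n

    onEdge⇒adj : OnEdge x y → Adj H x y
    onEdge⇒adj (u , v , e , inj₁ n) = linked⇒next (proj₁ (path-isPath e)) n
    onEdge⇒adj (u , v , e , inj₂ n) = N-sym H (linked⇒next (proj₁ (path-isPath e)) n)

    onVertex⇒∈V : OnVertex x → x ∈ V H
    onVertex⇒∈V (inj₁ (u , u∈ , refl))    = ρ-V u∈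
    onVertex⇒∈V (inj₂ (u , v , e , x∈)) =
      path-inner⊆V {G = H} x∈ (walk⇒path (linked⇒walk (inner u v) (proj₁ (path-isPath e))))

  -- Exactly the vertices and edges on the embedded paths are kept, which makes the covering
  -- conditions hold. Membership is decidable by a finite search over the edges of `J`.
  spanned : Graph n
  spanned = record
    { V        = decSubset onVertex?
    ; N        = λ x → decSubset (onEdge? x)
    ; N⊆V      = λ {x} y∈ → ∈-decSubset⁺ onVertex? (onEdge⇒onVertex (∈-decSubset⁻ (onEdge? x) y∈))
    ; N-sym    = λ {x} {y} y∈ → ∈-decSubset⁺ (onEdge? y) (onEdge-sym (∈-decSubset⁻ (onEdge? x) y∈))
    ; N-irrefl = λ {x} x∈ → N-irrefl H (onEdge⇒adj (∈-decSubset⁻ (onEdge? x) x∈))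
    }

  spanned⊑ : spanned ⊑ H
  spanned⊑ = onVertex⇒∈V ∘ ∈-decSubset⁻ onVertex? , λ x → onEdge⇒adj ∘ ∈-decSubset⁻ (onEdge? x)

  spanned-isSubdivision : IsSubdivision J spanned
  spanned-isSubdivision = record
    { ρ              = ρ
    ; inner          = inner
    ; ρ-V            = λ u∈ → ∈-decSubset⁺ onVertex? (inj₁ (_ , u∈ , refl))
    ; ρ-injective    = ρ-injective
    ; path-isPath    = λ {u} {v} e →
        next⇒linked (path u v) (λ {x} n → ∈-decSubset⁺ (onEdge? x) (u , v , e , inj₁ n)) ,
        proj₂ (path-isPath e)
    ; inner-avoids-ρ = inner-avoids-ρ
    ; inner-disjoint = inner-disjoint
    ; covers-V       = ∈-decSubset⁻ onVertex?
    ; covers-E       = λ {x} y∈ → to-consecutive (∈-decSubset⁻ (onEdge? x) y∈)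
    }
    where
    to-consecutive : OnEdge x y → ∃[ u ] ∃[ v ] Edge J u v ×
                     (Consecutive x y (path u v) ⊎ Consecutive y x (path u v))
    to-consecutive (u , v , e , inj₁ n) = u , v , e , inj₁ (next⇒consecutive n)
    to-consecutive (u , v , e , inj₂ n) = u , v , e , inj₂ (next⇒consecutive n)

-- Branch vertices of a subdivision and adjacency between them.

module _ {J : Graph m} {H : Graph n} (S : IsSubdivision J H) where

  open IsSubdivision S

  inner-∈-path : Edge J u v → Edge J w z → x ∈ˡ inner u v → x ∈ˡ path w z → w ≡ u × z ≡ v
  inner-∈-path {w = w} {z = z} e e′ x∈ x∈′ with ∈-path⁻ (inner w z) x∈′
  ... | inj₁ refl       = contradiction x∈ (inner-avoids-ρ e (N⊆V J (N-sym J (proj₂ e′))))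
  ... | inj₂ (inj₁ x∈″) = inner-disjoint e′ e x∈″ x∈
  ... | inj₂ (inj₂ refl) = contradiction x∈ (inner-avoids-ρ e (N⊆V J (proj₂ e′)))

  -- An internal vertex lies on one path only, so every edge at it belongs to that path and leads to
  -- its predecessor or its successor there.
  inner-degree : Edge J u v → x ∈ˡ inner u v → ∣ N H x ∣ ≤ⁿ 2
  inner-degree {u} {v} {x} e x∈
    with p , s , px , xs ← next-inner {u = ρ u} {v = ρ v} x∈ =
    ⊆ˡ⇒∣p∣≤length (N H x) (p ∷ s ∷ []) neighbour
    where
    neighbour : ∀ {y} → Adj H x y → y ∈ˡ p ∷ s ∷ []
    neighbour xy with covers-E xy
    ... | _ , _ , e′ , inj₁ c
      with refl , refl ← inner-∈-path e e′ x∈ (next⇒∈ˡ (consecutive⇒next c)) =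
      there (here (next-unique (proj₂ (path-isPath e)) (consecutive⇒next c) xs))
    ... | _ , _ , e′ , inj₂ c
      with refl , refl ← inner-∈-path e e′ x∈ (next⇒∈ʳ (consecutive⇒next c)) =
      here (previous-unique (proj₂ (path-isPath e)) (consecutive⇒next c) px)

  branch⇒ρ : BranchVertex H x → ∃[ u ] u ∈ V J × x ≡ ρ u
  branch⇒ρ (x∈V , 3≤) with covers-V x∈V
  ... | inj₁ found              = found
  ... | inj₂ (u , v , e , x∈) = contradiction (inner-degree e x∈) (ℕ.<⇒≱ 3≤)

  -- On a path with internal vertices every step involves one of them, and `ρ` avoids them all.
  next-ρ : ∀ {i j u v} → i ∈ V J → j ∈ V J → Edge J u v → Next (ρ i) (ρ j) (path u v) →
           i ≡ u × j ≡ v × inner u v ≡ []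
  next-ρ {i} {j} {u} {v} i∈ j∈ e = go (inner u v) (λ w∈ → inner-avoids-ρ e w∈)
    where
    u∈ : u ∈ V J
    u∈ = N⊆V J (N-sym J (proj₂ e))
    go : ∀ xs → (∀ {w} → w ∈ V J → ¬ (ρ w ∈ˡ xs)) → Next (ρ i) (ρ j) (ρ u ∷ xs ∷ʳ ρ v) →
         i ≡ u × j ≡ v × xs ≡ []
    go [] _ k with ρ i in ρi | ρ j in ρj | k
    ... | _ | _ | here = ρ-injective i∈ u∈ ρi , ρ-injective j∈ (N⊆V J (proj₂ e)) ρj , refl
    ... | _ | _ | there (there ())
    go (_ ∷ _) avoids k with next-avoiding-inner k
    ... | inj₁ i∈xs = contradiction i∈xs (avoids i∈)
    ... | inj₂ j∈xs = contradiction j∈xs (avoids j∈)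

  adj-ρ : ∀ {i j} → i ∈ V J → j ∈ V J → Adj H (ρ i) (ρ j) →
          (Edge J i j × inner i j ≡ []) ⊎ (Edge J j i × inner j i ≡ [])
  adj-ρ i∈ j∈ ij with covers-E ij
  ... | u , v , e , inj₁ c with refl , refl , eq ← next-ρ i∈ j∈ e (consecutive⇒next c) = inj₁ (e , eq)
  ... | u , v , e , inj₂ c with refl , refl , eq ← next-ρ j∈ i∈ e (consecutive⇒next c) = inj₂ (e , eq)

-- Two long paths at a branch vertex exclude the cycle.

module _ {H : Graph n} (S : IsSubdivision K₄ H) where

  open IsSubdivision S

  private
    first : ∀ {i j} → Edge K₄ i j → ∃[ y ] Adj H (ρ i) y × (inner i j ≡ [] × y ≡ ρ j ⊎ y ∈ˡ inner i j)
    first {i} {j} e = path-first (walk⇒path {G = H} (linked⇒walk (inner i j) (proj₁ (path-isPath e))))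

    first-long : ∀ {i j} → Edge K₄ i j → inner i j ≢ [] → ∃[ y ] Adj H (ρ i) y × y ∈ˡ inner i j
    first-long e ≢[] with first e
    ... | _ , _ , inj₁ (≡[] , _) = contradiction ≡[] ≢[]
    ... | y , a , inj₂ y∈        = y , a , y∈

    e₀₁ : Edge K₄ zero (suc zero)
    e₀₁ = s≤s z≤n , there here

    e₀₂ : Edge K₄ zero (suc (suc zero))
    e₀₂ = s≤s z≤n , there (there here)

    e₀₃ : Edge K₄ zero (suc (suc (suc zero)))
    e₀₃ = s≤s z≤n , there (there (there here))

  module _ (long₁ : inner zero (suc zero) ≢ []) (long₂ : inner zero (suc (suc zero)) ≢ []) where

    private
      -- The first vertices of the three paths leaving `ρ zero` are distinct: two are internal to
      -- different paths, and the third is internal to the last path or is its far end.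
      ρ₀-branch : BranchVertex H (ρ zero)
      ρ₀-branch
        with y₁ , a₁ , y₁∈ ← first-long e₀₁ long₁ | y₂ , a₂ , y₂∈ ← first-long e₀₂ long₂
           | y₃ , a₃ , y₃∈ ← first e₀₃ =
        ρ-V ∈⊤ , three≤∣p∣ a₁ a₂ a₃ y₁≢y₂ (distinct e₀₁ y₁∈ (λ ()) y₃∈) (distinct e₀₂ y₂∈ (λ ()) y₃∈)
        where
        y₁≢y₂ : y₁ ≢ y₂
        y₁≢y₂ refl with () ← inner-disjoint e₀₁ e₀₂ y₁∈ y₂∈
        distinct : ∀ {y y′ i} → Edge K₄ zero i → y ∈ˡ inner zero i → i ≢ suc (suc (suc zero)) →
                   let j = suc (suc (suc zero)) in
                   inner zero j ≡ [] × y′ ≡ ρ j ⊎ y′ ∈ˡ inner zero j → y ≢ y′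
        distinct e y∈ i≢3 (inj₁ (_ , refl)) refl = inner-avoids-ρ e ∈⊤ y∈
        distinct e y∈ i≢3 (inj₂ y′∈)        refl = i≢3 (proj₂ (inner-disjoint e e₀₃ y∈ y′∈))

      ρ₀-neighbour : BranchVertex H y → Adj H (ρ zero) y → y ≡ ρ (suc (suc (suc zero)))
      ρ₀-neighbour b a with j , _ , refl ← branch⇒ρ S b with adj-ρ S {zero} {j} ∈⊤ ∈⊤ a
      ... | inj₂ ((() , _) , _)
      ... | inj₁ (e , ≡[]) with j
      ...   | zero                  = contradiction (proj₁ e) λ ()
      ...   | suc zero              = contradiction ≡[] long₁
      ...   | suc (suc zero)        = contradiction ≡[] long₂
      ...   | suc (suc (suc zero)) = refl

    -- The cycle would give `ρ zero` two distinct neighbours that are branch vertices, but only the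
    -- end of the third path can be one.
    no-cycle-on-branch-vertices : ¬ HasCycleOnBranchVertices H
    no-cycle-on-branch-vertices (xs , c , on)
      with y , z , y≢z , y∈ , z∈ , a , b ←
        cycle-neighbours c (Equivalence.from (on (ρ zero)) ρ₀-branch) =
      y≢z (trans (ρ₀-neighbour (Equivalence.to (on y) y∈) a)
                 (sym (ρ₀-neighbour (Equivalence.to (on z) z∈) b)))

-- Families of disjoint lists indexed by the edges of K₄.

lookup-injective : ∀ {xs : List (Fin n)} → Unique xs → ∀ i j → lookup xs i ≡ lookup xs j → i ≡ j
lookup-injective {xs = _ ∷ _}  _          zero    zero    _  = refl
lookup-injective {xs = _ ∷ xs} (x∉ ∷ _)   zero    (suc j) eq =
  contradiction eq (All.lookup x∉ (∈-lookup j))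
lookup-injective {xs = _ ∷ xs} (x∉ ∷ _)   (suc i) zero    eq =
  contradiction (sym eq) (All.lookup x∉ (∈-lookup i))
lookup-injective {xs = _ ∷ xs} (_ ∷ uniq) (suc i) (suc j) eq =
  cong suc (lookup-injective uniq i j eq)

module _ {I A : Set} (f : I → List A) where

  ∈-concat-map : ∀ {e es x} → e ∈ˡ es → x ∈ˡ f e → x ∈ˡ concat (map f es)
  ∈-concat-map e∈ x∈ = ∈-concat⁺′ x∈ (∈-map⁺ f e∈)

  concat-map-unique : ∀ {e es} → Unique (concat (map f es)) → e ∈ˡ es → Unique (f e)
  concat-map-unique {es = e ∷ _} uniq (here refl) = Unique-++ˡ (f e) uniq
  concat-map-unique {es = e ∷ _} uniq (there e∈)  = concat-map-unique (Unique-++ʳ (f e) uniq) e∈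

  concat-map-disjoint : ∀ {d e es x} → Unique (concat (map f es)) → d ∈ˡ es → e ∈ˡ es →
                        x ∈ˡ f d → x ∈ˡ f e → d ≡ e
  concat-map-disjoint uniq (here refl) (here refl) _ _ = refl
  concat-map-disjoint {d = d} uniq (here refl) (there e∈) x∈d x∈e =
    contradiction (∈-concat-map e∈ x∈e) (Unique-++⇒∉ (f d) uniq x∈d)
  concat-map-disjoint {e = e} uniq (there d∈) (here refl) x∈d x∈e =
    contradiction (∈-concat-map d∈ x∈d) (Unique-++⇒∉ (f e) uniq x∈e)
  concat-map-disjoint {es = c ∷ _} uniq (there d∈) (there e∈) =
    concat-map-disjoint (Unique-++ʳ (f c) uniq) d∈ e∈

K₄-edges : List (Fin 4 × Fin 4)
K₄-edges = (0F , 1F) ∷ (0F , 2F) ∷ (0F , 3F) ∷ (1F , 2F) ∷ (1F , 3F) ∷ (2F , 3F) ∷ []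

∈-K₄-edges : ∀ {i j} → i < j → (i , j) ∈ˡ K₄-edges
∈-K₄-edges {i} {j} = from-yes (all? λ i → all? λ j → (i <? j) →-dec ((i , j) ∈ˡ? K₄-edges)) i j
  where open DecMembership (≡-dec _≟_ (_≟_ {4})) using () renaming (_∈?_ to _∈ˡ?_)

lists₄ : (ab ac ad bc bd cd : List (Fin m)) → Fin 4 × Fin 4 → List (Fin m)
lists₄ ab ac ad bc bd cd (0F , 1F) = ab
lists₄ ab ac ad bc bd cd (0F , 2F) = ac
lists₄ ab ac ad bc bd cd (0F , 3F) = ad
lists₄ ab ac ad bc bd cd (1F , 2F) = bc
lists₄ ab ac ad bc bd cd (1F , 3F) = bd
lists₄ ab ac ad bc bd cd (2F , 3F) = cd
lists₄ ab ac ad bc bd cd _         = []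

-- Expanding walks of J to walks of H.

module _ {J : Graph m} {H : Graph n} (S : IsSubdivision J H) where

  open IsSubdivision S

  private
    source : Adj J u v → u ∈ V J
    source = N⊆V J ∘ N-sym J

    ≮⇒edge : Adj J u v → ¬ (u < v) → Edge J v u
    ≮⇒edge {u} {v} e u≮v with <-cmp u v
    ... | tri< u<v _ _ = contradiction u<v u≮v
    ... | tri≈ _ refl _ = contradiction e (N-irrefl J)
    ... | tri> _ _ v<u = v<u , N-sym J e

  -- A subdivision stores the path of an edge in one orientation; here it can be read in both.
  segment : Fin m → Fin m → List (Fin n)
  segment u v with u <? v
  ... | yes _ = inner u v
  ... | no  _ = reverse (inner v u)

  segment-walk : Adj J u v → Walk H (ρ u) (segment u v) (ρ v)
  segment-walk {u} {v} e with u <? v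
  ... | yes u<v = linked⇒walk (inner u v) (proj₁ (path-isPath (u<v , e)))
  ... | no  u≮v = walk-reverse (linked⇒walk (inner v u) (proj₁ (path-isPath (≮⇒edge e u≮v))))

  segment-unique : Adj J u v → Unique (segment u v)
  segment-unique {u} {v} e with u <? v
  ... | yes u<v with _ ∷ uniq ← proj₂ (path-isPath (u<v , e)) = Unique-++ˡ (inner u v) uniq
  ... | no  u≮v with _ ∷ uniq ← proj₂ (path-isPath (≮⇒edge e u≮v)) =
    Unique-resp-↭ (↭-sym (↭-reverse (inner v u))) (Unique-++ˡ (inner v u) uniq)

  ∈-segment : Adj J u v → x ∈ˡ segment u v →
              (Edge J u v × x ∈ˡ inner u v) ⊎ (Edge J v u × x ∈ˡ inner v u)
  ∈-segment {u} {v} e x∈ with u <? v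
  ... | yes u<v = inj₁ ((u<v , e) , x∈)
  ... | no  u≮v = inj₂ (≮⇒edge e u≮v , reverse⁻ x∈)

  segment-avoids-ρ : Adj J u v → w ∈ V J → ¬ (ρ w ∈ˡ segment u v)
  segment-avoids-ρ e w∈ ρw∈ with ∈-segment e ρw∈
  ... | inj₁ (e′ , ρw∈) = inner-avoids-ρ e′ w∈ ρw∈
  ... | inj₂ (e′ , ρw∈) = inner-avoids-ρ e′ w∈ ρw∈

  segment-disjoint : ∀ {u′ v′} → Adj J u v → Adj J u′ v′ → x ∈ˡ segment u v → x ∈ˡ segment u′ v′ →
                     (u ≡ u′ × v ≡ v′) ⊎ (u ≡ v′ × v ≡ u′)
  segment-disjoint e e′ x∈ x∈′ with ∈-segment e x∈ | ∈-segment e′ x∈′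
  ... | inj₁ (f , x∈) | inj₁ (f′ , x∈′) with p , q ← inner-disjoint f f′ x∈ x∈′ = inj₁ (p , q)
  ... | inj₁ (f , x∈) | inj₂ (f′ , x∈′) with p , q ← inner-disjoint f f′ x∈ x∈′ = inj₂ (p , q)
  ... | inj₂ (f , x∈) | inj₁ (f′ , x∈′) with p , q ← inner-disjoint f f′ x∈ x∈′ = inj₂ (q , p)
  ... | inj₂ (f , x∈) | inj₂ (f′ , x∈′) with p , q ← inner-disjoint f f′ x∈ x∈′ = inj₁ (q , p)

  segment-edge : Edge J u v → segment u v ≡ inner u v
  segment-edge {u} {v} (u<v , _) with u <? v
  ... | yes _   = refl
  ... | no  u≮v = contradiction u<v u≮v

  segment-edge-reverse : Edge J u v → segment v u ≡ reverse (inner u v)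
  segment-edge-reverse {u} {v} (u<v , _) with v <? u
  ... | yes v<u = contradiction v<u (<-asym u<v)
  ... | no  _   = refl

  -- The relation for which `Tetrahedra` is used: on an edge of `J` it says that the edge is not
  -- subdivided. `ShortEdge` adds the adjacency.
  Short : Fin m → Fin m → Set
  Short u v = segment u v ≡ []

  short? : ∀ u v → Dec (Short u v)
  short? u v with segment u v
  ... | []    = yes refl
  ... | _ ∷ _ = no λ ()

  short-sym : ∀ u v → Short u v → Short v u
  short-sym u v s with u <? v | v <? u
  ... | yes u<v | yes v<u = contradiction u<v (<-asym v<u)
  ... | yes _   | no _    = cong reverse s
  ... | no _    | yes _   = trans (sym (reverse-involutive (inner v u))) (cong reverse s)
  ... | no u≮v  | no v≮u with <-cmp u v
  ...   | tri< u<v _ _  = contradiction u<v u≮v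
  ...   | tri≈ _ refl _ = s
  ...   | tri> _ _ v<u  = contradiction v<u v≮u

  short-adj : Adj J u v → Short u v → Adj H (ρ u) (ρ v)
  short-adj e s = path-adj (subst (λ xs → Path H _ xs _) s (walk⇒path (segment-walk e)))

  expand : Fin m → List (Fin m) → Fin m → List (Fin n)
  expand u []       v = segment u v
  expand u (x ∷ xs) v = segment u x ++ ρ x ∷ expand x xs v

  expand-walk : Walk J u xs v → Walk H (ρ u) (expand u xs v) (ρ v)
  expand-walk (edge e) = segment-walk e
  expand-walk (e ∷ p)  = walk-++ (segment-walk e) (expand-walk p)

  OnSegment : Fin n → List (Fin m) → Set
  OnSegment x us = ∃₂ λ p q → Adj J p q × p ∈ˡ us × q ∈ˡ us × x ∈ˡ segment p q

  -- Both ends of the edge of `J` are recorded as vertices of the walk, so that a vertex of `H`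
  -- shared by two expanded walks can be traced back to a shared edge of `J`.
  ∈-expand : Walk J u xs v → x ∈ˡ expand u xs v →
             (∃[ w ] w ∈ˡ xs × x ≡ ρ w) ⊎ OnSegment x (u ∷ v ∷ xs)
  ∈-expand (edge e) x∈ = inj₂ (_ , _ , e , here refl , there (here refl) , x∈)
  ∈-expand {u} (_∷_ {x = y} e p) x∈ with ∈-++⁻ (segment u y) x∈
  ... | inj₁ x∈seg          = inj₂ (_ , _ , e , here refl , there (there (here refl)) , x∈seg)
  ... | inj₂ (here refl)    = inj₁ (y , here refl , refl)
  ... | inj₂ (there x∈rest) with ∈-expand p x∈rest
  ...   | inj₁ (w , w∈ , eq) = inj₁ (w , there w∈ , eq)
  ...   | inj₂ (p , q , e′ , p∈ , q∈ , x∈seg) = inj₂ (p , q , e′ , weaken p∈ , weaken q∈ , x∈seg)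
    where
    weaken : ∀ {u v y z : Fin m} {xs} → z ∈ˡ y ∷ v ∷ xs → z ∈ˡ u ∷ v ∷ y ∷ xs
    weaken (here refl)         = there (there (here refl))
    weaken (there (here refl)) = there (here refl)
    weaken (there (there z∈))  = there (there (there z∈))

  ρ∉expand : Walk J u xs v → w ∈ V J → ¬ (w ∈ˡ xs) → ¬ (ρ w ∈ˡ expand u xs v)
  ρ∉expand p w∈ w∉xs ρw∈ with ∈-expand p ρw∈
  ... | inj₁ (y , y∈ , eq) =
    w∉xs (subst (_∈ˡ _) (sym (ρ-injective w∈ (path-inner⊆V y∈ (walk⇒path p)) eq)) y∈)
  ... | inj₂ (_ , _ , e , _ , _ , ρw∈seg) = segment-avoids-ρ e w∈ ρw∈seg

  expand-unique : Walk J u xs v → Unique (u ∷ v ∷ xs) → Unique (expand u xs v)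
  expand-unique (edge e) _ = segment-unique e
  expand-unique {u} {x ∷ xs} {v} (e ∷ p) ((u≢v ∷ u≢x ∷ u∉) ∷ (v≢x ∷ v∉) ∷ (x∉ ∷ uniq)) =
    Unique-++-all (segment-unique e)
      (All.¬Any⇒All¬ _ (ρ∉expand p (walk-source p) (λ x∈ → All.lookup x∉ x∈ refl)) ∷
       expand-unique p ((≢-sym v≢x ∷ x∉) ∷ v∉ ∷ uniq))
      (segment-avoids-ρ e (walk-source p) ∷ All.tabulate disjoint)
    where
    disjoint : ∀ {z} → z ∈ˡ expand x xs v → ¬ (z ∈ˡ segment u x)
    disjoint z∈ z∈seg with ∈-expand p z∈
    ... | inj₁ (w , w∈ , refl) = segment-avoids-ρ e (path-inner⊆V w∈ (walk⇒path p)) z∈seg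
    ... | inj₂ (_ , _ , e′ , p∈ , q∈ , z∈′) with segment-disjoint e e′ z∈seg z∈′
    -- A shared vertex would put `u` on the remaining walk.
    ...   | inj₁ (refl , _) = All.lookup (u≢x ∷ u≢v ∷ u∉) p∈ refl
    ...   | inj₂ (refl , _) = All.lookup (u≢x ∷ u≢v ∷ u∉) q∈ refl

  expand-isPath : Walk J u xs v → Unique (u ∷ v ∷ xs) → IsPath H (ρ u ∷ expand u xs v ∷ʳ ρ v)
  expand-isPath {u} {xs} {v} p uniq@((u≢v ∷ u∉) ∷ v∉ ∷ _) =
    walk⇒linked (expand-walk p) ,
    Unique-resp-↭ (↭-prep (ρ u) (∷↭∷ʳ (ρ v) (expand u xs v)))
      (((λ eq → u≢v (ρ-injective u∈ v∈ eq)) ∷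
        All.¬Any⇒All¬ _ (ρ∉expand p u∈ (λ u∈xs → All.lookup u∉ u∈xs refl))) ∷
       All.¬Any⇒All¬ _ (ρ∉expand p v∈ (λ v∈xs → All.lookup v∉ v∈xs refl)) ∷
       expand-unique p uniq)
    where
    u∈ = walk-source p
    v∈ = path-source (path-sym (walk⇒path p))

  -- A subdivided K₄ in J gives one in H.

  module _ {a b c d : Fin m} {ab ac ad bc bd cd : List (Fin m)}
           (w-ab : Walk J a ab b) (w-ac : Walk J a ac c) (w-ad : Walk J a ad d)
           (w-bc : Walk J b bc c) (w-bd : Walk J b bd d) (w-cd : Walk J c cd d)
           (uniq : Unique ((a ∷ b ∷ c ∷ d ∷ []) ++
                           concat (map (lists₄ ab ac ad bc bd cd) K₄-edges))) where

    private
      corner : Fin 4 → Fin m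
      corner = lookup (a ∷ b ∷ c ∷ d ∷ [])

      list : Fin 4 → Fin 4 → List (Fin m)
      list i j = lists₄ ab ac ad bc bd cd (i , j)

      walk : ∀ {i j} → i < j → Walk J (corner i) (list i j) (corner j)
      walk {i} {j} i<j with i | j | ∈-K₄-edges i<j
      ... | _ | _ | here refl                                 = w-ab
      ... | _ | _ | there (here refl)                         = w-ac
      ... | _ | _ | there (there (here refl))                 = w-ad
      ... | _ | _ | there (there (there (here refl)))         = w-bc
      ... | _ | _ | there (there (there (there (here refl)))) = w-bd
      ... | _ | _ | there (there (there (there (there (here refl))))) = w-cd

      corners-unique : Unique (a ∷ b ∷ c ∷ d ∷ [])
      corners-unique = Unique-++ˡ (a ∷ b ∷ c ∷ d ∷ []) uniq

      lists-unique : Unique (concat (map (lists₄ ab ac ad bc bd cd) K₄-edges))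
      lists-unique = Unique-++ʳ (a ∷ b ∷ c ∷ d ∷ []) uniq

      corner∉list : ∀ {i j} → i < j → ∀ k → ¬ (corner k ∈ˡ list i j)
      corner∉list i<j k c∈ = Unique-++⇒∉ (a ∷ b ∷ c ∷ d ∷ []) uniq (∈-lookup k)
        (∈-concat-map (lists₄ ab ac ad bc bd cd) (∈-K₄-edges i<j) c∈)

      list-disjoint : ∀ {i j k l x} → i < j → k < l → x ∈ˡ list i j → x ∈ˡ list k l → i ≡ k × j ≡ l
      list-disjoint i<j k<l x∈ x∈′
        with refl ← concat-map-disjoint (lists₄ ab ac ad bc bd cd) lists-unique
                      (∈-K₄-edges i<j) (∈-K₄-edges k<l) x∈ x∈′ = refl , refl

      closed-unique : ∀ {i j} → i < j → Unique (corner i ∷ corner j ∷ list i j)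
      closed-unique {i} {j} i<j =
        ((λ eq → <-irrefl (lookup-injective corners-unique i j eq) i<j) ∷
          All.¬Any⇒All¬ _ (corner∉list i<j i)) ∷
        All.¬Any⇒All¬ _ (corner∉list i<j j) ∷
        concat-map-unique (lists₄ ab ac ad bc bd cd) lists-unique (∈-K₄-edges i<j)

      -- Corners avoid the inner lists, and inner lists of different edges are disjoint, so two
      -- different paths share at most corners.
      common : ∀ {i j k l x} → i < j → k < l →
               x ∈ˡ corner i ∷ corner j ∷ list i j → x ∈ˡ corner k ∷ corner l ∷ list k l →
               (i ≡ k × j ≡ l) ⊎ (∃[ e ] x ≡ corner e × (e ≡ i ⊎ e ≡ j) × (e ≡ k ⊎ e ≡ l))
      common {i} {j} {k} {l} i<j k<l x∈ x∈′ with corner-or-list x∈ | corner-or-list x∈′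
        where
        corner-or-list : ∀ {i j x} → x ∈ˡ corner i ∷ corner j ∷ list i j →
                         (∃[ e ] x ≡ corner e × (e ≡ i ⊎ e ≡ j)) ⊎ x ∈ˡ list i j
        corner-or-list (here eq)          = inj₁ (_ , eq , inj₁ refl)
        corner-or-list (there (here eq))  = inj₁ (_ , eq , inj₂ refl)
        corner-or-list (there (there x∈)) = inj₂ x∈
      ... | inj₂ x∈ | inj₂ x∈′ = inj₁ (list-disjoint i<j k<l x∈ x∈′)
      ... | inj₁ (e , refl , _) | inj₂ x∈′ = contradiction x∈′ (corner∉list k<l e)
      ... | inj₂ x∈ | inj₁ (e , refl , _) = contradiction x∈ (corner∉list i<j e)
      ... | inj₁ (e , refl , e∈) | inj₁ (e′ , eq , e∈′)
        with refl ← lookup-injective corners-unique e e′ eq = inj₂ (e , refl , e∈ , e∈′)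

      two-common : ∀ {i j k l e f : Fin 4} → i < j → k < l → e ≢ f →
                   e ≡ i ⊎ e ≡ j → e ≡ k ⊎ e ≡ l → f ≡ i ⊎ f ≡ j → f ≡ k ⊎ f ≡ l → i ≡ k × j ≡ l
      two-common i<j k<l e≢f (inj₁ refl) (inj₁ refl) (inj₂ refl) (inj₂ refl) = refl , refl
      two-common i<j k<l e≢f (inj₂ refl) (inj₂ refl) (inj₁ refl) (inj₁ refl) = refl , refl
      two-common i<j k<l e≢f (inj₁ refl) (inj₂ refl) (inj₂ refl) (inj₁ refl) = contradiction i<j (<-asym k<l)
      two-common i<j k<l e≢f (inj₂ refl) (inj₁ refl) (inj₁ refl) (inj₂ refl) = contradiction i<j (<-asym k<l)
      two-common i<j k<l e≢f (inj₁ refl) _ (inj₁ refl) _ = contradiction refl e≢f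
      two-common i<j k<l e≢f (inj₂ refl) _ (inj₂ refl) _ = contradiction refl e≢f
      two-common i<j k<l e≢f _ (inj₁ refl) _ (inj₁ refl) = contradiction refl e≢f
      two-common i<j k<l e≢f _ (inj₂ refl) _ (inj₂ refl) = contradiction refl e≢f

      expanded : Fin 4 → Fin 4 → List (Fin n)
      expanded i j = expand (corner i) (list i j) (corner j)

      corner∈V : ∀ k → corner k ∈ V J
      corner∈V 0F = walk-source w-ab
      corner∈V 1F = walk-source w-bc
      corner∈V 2F = walk-source w-cd
      corner∈V 3F = path-source (path-sym (walk⇒path w-cd))

      -- A common vertex inside a segment comes from an edge of `J` whose two ends lie on both
      -- paths. If both ends are common corners, the two edges of K₄ have the same ends.
      expanded-disjoint : ∀ {i j k l x} → i < j → k < l →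
                          x ∈ˡ expanded i j → x ∈ˡ expanded k l → i ≡ k × j ≡ l
      expanded-disjoint i<j k<l x∈ x∈′ with ∈-expand (walk i<j) x∈ | ∈-expand (walk k<l) x∈′
      ... | inj₁ (u , u∈ , refl) | inj₁ (v , v∈ , eq)
        with refl ← ρ-injective (path-inner⊆V u∈ (walk⇒path (walk i<j)))
                                (path-inner⊆V v∈ (walk⇒path (walk k<l))) eq =
        list-disjoint i<j k<l u∈ v∈
      ... | inj₁ (u , u∈ , refl) | inj₂ (_ , _ , e , _ , _ , x∈seg) =
        contradiction x∈seg (segment-avoids-ρ e (path-inner⊆V u∈ (walk⇒path (walk i<j))))
      ... | inj₂ (_ , _ , e , _ , _ , x∈seg) | inj₁ (u , u∈ , refl) =
        contradiction x∈seg (segment-avoids-ρ e (path-inner⊆V u∈ (walk⇒path (walk k<l))))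
      ... | inj₂ (p , q , e , p∈ , q∈ , x∈seg) | inj₂ (p′ , q′ , e′ , p∈′ , q∈′ , x∈seg′) =
        [ (λ { (refl , refl) → same p∈′ q∈′ }) , (λ { (refl , refl) → same q∈′ p∈′ }) ]′
          (segment-disjoint e e′ x∈seg x∈seg′)
        where
        same : p ∈ˡ _ → q ∈ˡ _ → _
        same p∈′ q∈′ with common i<j k<l p∈ p∈′ | common i<j k<l q∈ q∈′
        ... | inj₁ eq | _ = eq
        ... | _ | inj₁ eq = eq
        -- The two common corners differ because `J` has no loops.
        ... | inj₂ (f , refl , f∈ , f∈′) | inj₂ (g , refl , g∈ , g∈′) =
          two-common i<j k<l (λ { refl → N-irrefl J e }) f∈ f∈′ g∈ g∈′

    -- Subdivision is transitive: the edges on the six walks of `J` are replaced by their segments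
    -- in `H`.
    K₄-embedding : Embedding K₄ H
    K₄-embedding = record
      { ρ              = ρ ∘ corner
      ; inner          = expanded
      ; ρ-V            = λ {i} _ → ρ-V (corner∈V i)
      ; ρ-injective    = λ {i} {j} _ _ eq →
          lookup-injective corners-unique i j (ρ-injective (corner∈V i) (corner∈V j) eq)
      ; path-isPath    = λ (i<j , _) → expand-isPath (walk i<j) (closed-unique i<j)
      ; inner-avoids-ρ = λ {i} {j} {k} (i<j , _) _ →
          ρ∉expand (walk i<j) (corner∈V k) (corner∉list i<j k)
      ; inner-disjoint = λ (i<j , _) (k<l , _) → expanded-disjoint i<j k<l
      }

≢-triangle : ∀ {x y z : Bool} → x ≢ y → y ≢ z → ¬ (x ≢ z)
≢-triangle {true}  {true}          x≢y y≢z x≢z = x≢y refl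
≢-triangle {false} {false}         x≢y y≢z x≢z = x≢y refl
≢-triangle {true}  {false} {true}  x≢y y≢z x≢z = x≢z refl
≢-triangle {true}  {false} {false} x≢y y≢z x≢z = y≢z refl
≢-triangle {false} {true}  {true}  x≢y y≢z x≢z = y≢z refl
≢-triangle {false} {true}  {false} x≢y y≢z x≢z = x≢z refl

-- Translating the outcomes for J into statements about H.

module _ {J : Graph m} {H : Graph n} (S : IsSubdivision J H) where

  open IsSubdivision S
  open Tetrahedra J (Short S) (short? S) (short-sym S)

  expand-long : ∀ u xs v → Long u xs v → expand S u xs v ≢ []
  expand-long u []       v (inj₁ []≢[]) = contradiction refl []≢[]
  expand-long u []       v (inj₂ ¬s)    = ¬s
  expand-long u (x ∷ xs) v _            = ++∷≢[] (segment S u x)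

  long-resp : ∀ u v {xs ys} → ys ↭ xs → Long u xs v → Long u ys v
  long-resp _ _ ys↭xs (inj₁ xs≢[]) = inj₁ λ { refl → xs≢[] (↭-empty-inv (↭-sym ys↭xs)) }
  long-resp _ _ _     (inj₂ ¬s)    = inj₂ ¬s

  long-tetra⇒subgraph : LongTetra →
    Σ[ H′ ∈ Graph n ] (H′ ⊑ H × IsSubdivision K₄ H′ × ¬ HasCycleOnBranchVertices H′)
  long-tetra⇒subgraph (longTetra {a} {b} {c} {d} (tetra (ab , p , ab↭) (ac , q , ac↭) (ad , r , ad↭)
                        (bc , s , bc↭) (bd , t , bd↭) (cd , u , cd↭) uniq) long-ab long-ac) =
    spanned E , spanned⊑ E , spanned-isSubdivision E ,
    no-cycle-on-branch-vertices (spanned-isSubdivision E)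
      (expand-long a ab b (long-resp a b ab↭ long-ab)) (expand-long a ac c (long-resp a c ac↭ long-ac))
    where
    -- The lists of a `Path` are known only up to order, so they are exchanged for those of the
    -- actual walks; `concat` also leaves an empty list at the end.
    E = K₄-embedding S p q r s t u (Unique-resp-↭ (↭-sym
          (++⁺ˡ (a ∷ b ∷ c ∷ d ∷ [])
            (++⁺ ab↭ (++⁺ ac↭ (++⁺ ad↭ (++⁺ bc↭ (++⁺ bd↭ (↭-trans (++-identityʳ cd) cd↭)))))))) uniq)

  module _ {a b c d} (T : Tetra a b c d [] [] [] [] [] [])
           (cover : ∀ {v} → v ∈ V J → v ∈ˡ a ∷ b ∷ c ∷ d ∷ []) where

    private
      open Tetra T

      E : Embedding K₄ H
      E = K₄-embedding S (edge (path-adj path-ab)) (edge (path-adj path-ac)) (edge (path-adj path-ad))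
            (edge (path-adj path-bc)) (edge (path-adj path-bd)) (edge (path-adj path-cd)) unique

      corner : Fin 4 → Fin m
      corner = lookup (a ∷ b ∷ c ∷ d ∷ [])

      corner-of : ∀ {v} → v ∈ V J → ∃[ i ] v ≡ corner i
      corner-of v∈ = index (cover v∈) , lookup-index (cover v∈)

      inner-segment : ∀ {i j} → i < j → Embedding.inner E i j ≡ segment S (corner i) (corner j)
      inner-segment {i} {j} i<j with i | j | ∈-K₄-edges i<j
      ... | _ | _ | here refl                                         = refl
      ... | _ | _ | there (here refl)                                 = refl
      ... | _ | _ | there (there (here refl))                         = refl
      ... | _ | _ | there (there (there (here refl)))                 = refl
      ... | _ | _ | there (there (there (there (here refl))))         = refl
      ... | _ | _ | there (there (there (there (there (here refl))))) = refl

      K₄-edge : ∀ {i j} → i < j → Edge K₄ i j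
      K₄-edge i<j = i<j , x∉p⇒x∈∁p λ j∈ → <-irrefl (sym (x∈⁅y⁆⇒x≡y _ j∈)) i<j

      -- The order of two corners in `Fin 4` need not agree with that of their names in `Fin m`, so
      -- the path of an edge may appear reversed.
      edge-of : ∀ {u v} → Edge J u v → ∃₂ λ i j → Edge K₄ i j ×
        (Embedding.path E i j ≡ path u v × Embedding.inner E i j ≡ inner u v ⊎
         Embedding.path E i j ≡ reverse (path u v) × Embedding.inner E i j ≡ reverse (inner u v))
      edge-of {u} {v} e
        with i , refl ← corner-of (N⊆V J (N-sym J (proj₂ e))) | j , refl ← corner-of (N⊆V J (proj₂ e))
        with <-cmp i j
      ... | tri≈ _ refl _ = contradiction (proj₂ e) (N-irrefl J)
      ... | tri< i<j _ _ =
        let eq = trans (inner-segment i<j) (segment-edge S e)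
        in i , j , K₄-edge i<j , inj₁ (cong (λ xs → ρ u ∷ xs ∷ʳ ρ v) eq , eq)
      ... | tri> _ _ j<i =
        let eq = trans (inner-segment j<i) (segment-edge-reverse S e)
        in j , i , K₄-edge j<i , inj₂ (trans (cong (λ xs → ρ v ∷ xs ∷ʳ ρ u) eq) (sym reverse-path) , eq)
        where
        reverse-path : reverse (path u v) ≡ ρ v ∷ reverse (inner u v) ∷ʳ ρ u
        reverse-path = trans (unfold-reverse (ρ u) (inner u v ∷ʳ ρ v))
          (cong (_∷ʳ ρ u) (reverse-++ (inner u v) [ ρ v ]))

      covers-V′ : ∀ {x} → x ∈ V H → (∃[ i ] i ∈ V K₄ × x ≡ Embedding.ρ E i) ⊎
                  (∃[ i ] ∃[ j ] Edge K₄ i j × x ∈ˡ Embedding.inner E i j)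
      covers-V′ x∈ with covers-V x∈
      ... | inj₁ (u , u∈ , refl) with i , refl ← corner-of u∈ = inj₁ (i , ∈⊤ , refl)
      ... | inj₂ (u , v , e , x∈) with edge-of e
      ...   | i , j , f , inj₁ (_ , eq) = inj₂ (i , j , f , subst (_ ∈ˡ_) (sym eq) x∈)
      ...   | i , j , f , inj₂ (_ , eq) =
        inj₂ (i , j , f , subst (_ ∈ˡ_) (sym eq) (∈-resp-↭ (↭-sym (↭-reverse (inner u v))) x∈))

      next-edge : ∀ {u v x y} → Edge J u v → Next x y (path u v) →
                  ∃[ i ] ∃[ j ] Edge K₄ i j ×
                    (Next x y (Embedding.path E i j) ⊎ Next y x (Embedding.path E i j))
      next-edge e k with edge-of e
      ... | i , j , f , inj₁ (eq , _) = i , j , f , inj₁ (subst (Next _ _) (sym eq) k)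
      ... | i , j , f , inj₂ (eq , _) = i , j , f , inj₂ (subst (Next _ _) (sym eq) (next-reverse k))

    only-K₄⇒subdivision : IsSubdivision K₄ H
    only-K₄⇒subdivision = record
      { Embedding E
      ; covers-V = covers-V′
      ; covers-E = λ xy → covers (covers-E xy)
      }
      where
      covers : ∀ {x y} →
        ∃[ u ] ∃[ v ] Edge J u v × (Consecutive x y (path u v) ⊎ Consecutive y x (path u v)) →
        ∃[ i ] ∃[ j ] Edge K₄ i j ×
          (Consecutive x y (Embedding.path E i j) ⊎ Consecutive y x (Embedding.path E i j))
      covers (u , v , e , inj₁ c) with i , j , f , k ← next-edge e (consecutive⇒next c) =
        i , j , f , Sum.map next⇒consecutive next⇒consecutive k
      covers (u , v , e , inj₂ c) with i , j , f , k ← next-edge e (consecutive⇒next c) =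
        i , j , f , swap (Sum.map next⇒consecutive next⇒consecutive k)

  module _ {a₁ a₂ a₃ b₁ b₂ b₃} (K : K₃₃ a₁ a₂ a₃ b₁ b₂ b₃)
           (cover : ∀ {v} → v ∈ V J → v ∈ˡ a₁ ∷ a₂ ∷ a₃ ∷ b₁ ∷ b₂ ∷ b₃ ∷ [])
           (¬a₁₂ : ¬ Adj J a₁ a₂) (¬a₁₃ : ¬ Adj J a₁ a₃) (¬a₂₃ : ¬ Adj J a₂ a₃)
           (¬b₁₂ : ¬ Adj J b₁ b₂) (¬b₁₃ : ¬ Adj J b₁ b₃) (¬b₂₃ : ¬ Adj J b₂ b₃) where

    private
      corner : Fin 6 → Fin m
      corner = lookup (a₁ ∷ a₂ ∷ a₃ ∷ b₁ ∷ b₂ ∷ b₃ ∷ [])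

      corner-of : ∀ {v} → v ∈ V J → ∃[ i ] v ≡ corner i
      corner-of v∈ = index (cover v∈) , lookup-index (cover v∈)

      cross-edge : ∀ i j → Adj K₃,₃ i j → ShortEdge (corner i) (corner j)
      cross-edge 0F _ (there (there (there here))) = K₃₃.e₁₁ K
      cross-edge 0F _ (there (there (there (there here)))) = K₃₃.e₁₂ K
      cross-edge 0F _ (there (there (there (there (there here))))) = K₃₃.e₁₃ K
      cross-edge 1F _ (there (there (there here))) = K₃₃.e₂₁ K
      cross-edge 1F _ (there (there (there (there here)))) = K₃₃.e₂₂ K
      cross-edge 1F _ (there (there (there (there (there here))))) = K₃₃.e₂₃ K
      cross-edge 2F _ (there (there (there here))) = K₃₃.e₃₁ K
      cross-edge 2F _ (there (there (there (there here)))) = K₃₃.e₃₂ K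
      cross-edge 2F _ (there (there (there (there (there here))))) = K₃₃.e₃₃ K
      cross-edge 3F _ here = shortEdge-sym (K₃₃.e₁₁ K)
      cross-edge 3F _ (there here) = shortEdge-sym (K₃₃.e₂₁ K)
      cross-edge 3F _ (there (there here)) = shortEdge-sym (K₃₃.e₃₁ K)
      cross-edge 4F _ here = shortEdge-sym (K₃₃.e₁₂ K)
      cross-edge 4F _ (there here) = shortEdge-sym (K₃₃.e₂₂ K)
      cross-edge 4F _ (there (there here)) = shortEdge-sym (K₃₃.e₃₂ K)
      cross-edge 5F _ here = shortEdge-sym (K₃₃.e₁₃ K)
      cross-edge 5F _ (there here) = shortEdge-sym (K₃₃.e₂₃ K)
      cross-edge 5F _ (there (there here)) = shortEdge-sym (K₃₃.e₃₃ K)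
      cross-edge 3F _ (there (there (there (there (there (there ()))))))
      cross-edge 4F _ (there (there (there (there (there (there ()))))))
      cross-edge 5F _ (there (there (there (there (there (there ()))))))

      edge-crosses : ∀ i j → Adj J (corner i) (corner j) → Adj K₃,₃ i j
      edge-crosses 0F 0F e = contradiction e (N-irrefl J)
      edge-crosses 0F 1F e = contradiction e ¬a₁₂
      edge-crosses 0F 2F e = contradiction e ¬a₁₃
      edge-crosses 1F 0F e = contradiction (N-sym J e) ¬a₁₂
      edge-crosses 1F 1F e = contradiction e (N-irrefl J)
      edge-crosses 1F 2F e = contradiction e ¬a₂₃
      edge-crosses 2F 0F e = contradiction (N-sym J e) ¬a₁₃
      edge-crosses 2F 1F e = contradiction (N-sym J e) ¬a₂₃
      edge-crosses 2F 2F e = contradiction e (N-irrefl J)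
      edge-crosses 3F 3F e = contradiction e (N-irrefl J)
      edge-crosses 3F 4F e = contradiction e ¬b₁₂
      edge-crosses 3F 5F e = contradiction e ¬b₁₃
      edge-crosses 4F 3F e = contradiction (N-sym J e) ¬b₁₂
      edge-crosses 4F 4F e = contradiction e (N-irrefl J)
      edge-crosses 4F 5F e = contradiction e ¬b₂₃
      edge-crosses 5F 3F e = contradiction (N-sym J e) ¬b₁₃
      edge-crosses 5F 4F e = contradiction (N-sym J e) ¬b₂₃
      edge-crosses 5F 5F e = contradiction e (N-irrefl J)
      edge-crosses 0F 3F _ = there (there (there here))
      edge-crosses 0F 4F _ = there (there (there (there here)))
      edge-crosses 0F 5F _ = there (there (there (there (there here))))
      edge-crosses 1F 3F _ = there (there (there here))
      edge-crosses 1F 4F _ = there (there (there (there here)))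
      edge-crosses 1F 5F _ = there (there (there (there (there here))))
      edge-crosses 2F 3F _ = there (there (there here))
      edge-crosses 2F 4F _ = there (there (there (there here)))
      edge-crosses 2F 5F _ = there (there (there (there (there here))))
      edge-crosses 3F 0F _ = here
      edge-crosses 3F 1F _ = there here
      edge-crosses 3F 2F _ = there (there here)
      edge-crosses 4F 0F _ = here
      edge-crosses 4F 1F _ = there here
      edge-crosses 4F 2F _ = there (there here)
      edge-crosses 5F 0F _ = here
      edge-crosses 5F 1F _ = there here
      edge-crosses 5F 2F _ = there (there here)

      edge-corners : ∀ {u v} → Adj J u v →
                     ∃₂ λ i j → u ≡ corner i × v ≡ corner j × Adj K₃,₃ i j
      edge-corners e
        with i , refl ← corner-of (N⊆V J (N-sym J e)) | j , refl ← corner-of (N⊆V J e) =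
        i , j , refl , refl , edge-crosses i j e

      -- Every edge of `J` joins the two sides and is therefore one of the nine short edges.
      inner≡[] : ∀ {u v} → Edge J u v → inner u v ≡ []
      inner≡[] e with i , j , refl , refl , f ← edge-corners (proj₂ e) =
        trans (sym (segment-edge S e)) (proj₂ (cross-edge i j f))

      source : ∀ {u v} → ShortEdge u v → u ∈ V J
      source (e , _) = N⊆V J (N-sym J e)

      corner∈V : ∀ i → corner i ∈ V J
      corner∈V 0F = source (K₃₃.e₁₁ K)
      corner∈V 1F = source (K₃₃.e₂₁ K)
      corner∈V 2F = source (K₃₃.e₃₁ K)
      corner∈V 3F = source (shortEdge-sym (K₃₃.e₁₁ K))
      corner∈V 4F = source (shortEdge-sym (K₃₃.e₁₂ K))
      corner∈V 5F = source (shortEdge-sym (K₃₃.e₁₃ K))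

      vertex : Fin 6 → Fin n
      vertex = ρ ∘ corner

      vertex-injective : ∀ {i j} → vertex i ≡ vertex j → i ≡ j
      vertex-injective {i} {j} eq =
        lookup-injective (K₃₃.unique K) i j (ρ-injective (corner∈V i) (corner∈V j) eq)

      vertex-of : ∀ {x} → x ∈ V H → ∃[ i ] x ≡ vertex i
      vertex-of x∈ with covers-V x∈
      ... | inj₁ (u , u∈ , refl) with i , refl ← corner-of u∈ = i , refl
      ... | inj₂ (u , v , e , x∈) with () ← subst (_ ∈ˡ_) (inner≡[] e) x∈

      label : Fin n → Fin 6
      label x with any? (λ i → x ≟ vertex i)
      ... | yes (i , _) = i
      -- Every vertex of `H` is some `vertex i`, so this value occurs only outside `V H`.
      ... | no _        = 0F

      label-vertex : ∀ i → label (vertex i) ≡ i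
      label-vertex i with any? (λ j → vertex i ≟ vertex j)
      ... | yes (j , eq) = sym (vertex-injective eq)
      ... | no ¬found    = contradiction (i , refl) ¬found

      next-adj : ∀ {u v x y} → Edge J u v → Next x y (path u v) → Adj K₃,₃ (label x) (label y)
      next-adj e k
        with i , j , refl , refl , f ← edge-corners (proj₂ e)
        rewrite inner≡[] e with k
      ... | here = subst₂ (Adj K₃,₃) (sym (label-vertex i)) (sym (label-vertex j)) f
      ... | there (there ())

    only-K₃₃⇒≅ : H ≅ K₃,₃
    only-K₃₃⇒≅ = record
      { to       = label
      ; from     = vertex
      ; to-V     = λ _ → ∈⊤
      ; from-V   = λ {i} _ → ρ-V (corner∈V i)
      ; from∘to  = vertex-label
      ; to∘from  = λ {i} _ → label-vertex i
      ; to-Adj   = λ xy → to-adj (covers-E xy)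
      ; from-Adj = λ {i} {j} f → let e , s = cross-edge i j f in short-adj S e s
      }
      where
      vertex-label : ∀ {x} → x ∈ V H → vertex (label x) ≡ x
      vertex-label x∈ with i , refl ← vertex-of x∈ = cong vertex (label-vertex i)
      to-adj : ∀ {x y} →
        ∃[ u ] ∃[ v ] Edge J u v × (Consecutive x y (path u v) ⊎ Consecutive y x (path u v)) →
        Adj K₃,₃ (label x) (label y)
      to-adj (u , v , e , inj₁ c) = next-adj e (consecutive⇒next c)
      to-adj {x} {y} (u , v , e , inj₂ c) =
        N-sym K₃,₃ {label y} {label x} (next-adj e (consecutive⇒next c))

  -- Short edges of `J` are edges of `H`, and two sides cannot separate the three vertices of a
  -- triangle.
  no-short-triangle : Bipartite H →
                      ∀ {u v w} → ShortEdge u v → ShortEdge v w → ¬ ShortEdge u w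
  no-short-triangle (side , proper) (e , s) (f , t) (g , r) =
    ≢-triangle (proper (short-adj S e s)) (proper (short-adj S f t)) (proper (short-adj S g r))

theorem5p3 : ∀ {n : ℕ} (H : Graph n) → Bipartite H → Cyclically3Connected H →
    H ≅ K₃,₃ ⊎
    IsSubdivision K₄ H ⊎
    (Σ[ H′ ∈ Graph n ] (H′ ⊑ H × IsSubdivision K₄ H′ × ¬ HasCycleOnBranchVertices H′))
theorem5p3 H bip (_ , J , J3 , S) =
  conclude (outcome J (Short S) (short? S) (short-sym S) J3
    (no-short-triangle S bip))
  where
  conclude : Outcome J (Short S) (short? S) (short-sym S) → _
  conclude (only-K₃₃ K cover ¬a₁₂ ¬a₁₃ ¬a₂₃ ¬b₁₂ ¬b₁₃ ¬b₂₃) =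
    inj₁ (only-K₃₃⇒≅ S K cover ¬a₁₂ ¬a₁₃ ¬a₂₃ ¬b₁₂ ¬b₁₃ ¬b₂₃)
  conclude (only-K₄ T cover) = inj₂ (inj₁ (only-K₄⇒subdivision S T cover))
  conclude (long-tetra T)    = inj₂ (inj₂ (long-tetra⇒subgraph S T))
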